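{- Let $n\geq3$ and $k\geq3$. Then there exists a $k$-ary orientable sequence of order $n+1$ with period at least $k\,s_k(n-1)$, where $s_k(n-1)$ is as defined in the context.
   Context: A $k$-ary sequence is a periodic sequence $S=(s_i)$ with entries in $\mathbb{Z}_k$; its period is the least positive $p$ with $s_{i+p}=s_i$ for all $i$. Write $\mathbf{s}_N(i)=(s_i,\dots,s_{i+N-1})$. $S$ is an $N$-window sequence if $\mathbf{s}_N(i)=\mathbf{s}_N(j)$ implies $i\equiv j\pmod p$. An orientable sequence of order $N$ is a $k$-ary $N$-window sequence with $\mathbf{s}_N(i)\neq\mathbf{s}_N(j)^R$ for all $i,j$, where $\mathbf{u}^R$ denotes the reverse of $\mathbf{u}$. Let $\delta=1$ if $k$ is odd and $\delta=2$ if $k$ is even, and write $n=2^tm$ with $m$ odd. Define $s_k(n-1)=\frac{k^n-\delta(n(k^{(n-1)/2}-1)+1)}{2}$ if $n$ is odd, and $s_k(n-1)=\frac{k^n - \frac{nk^{(n-2)/2}}{2}(\delta^2+k) +n\delta k^{(m-1)/2} - m\delta(k^{(m-1)/2}-1)-\delta}{2}$ if $n$ is even. -}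

module Defs where

open import Data.Nat as ℕ using (ℕ; zero; suc; _%_; _/_; _∸_; _<_)
open import Data.Integer as ℤ using (ℤ; +_)
open import Data.Fin using (Fin; toℕ)
open import Data.Vec using (Vec; tabulate; reverse)
open import Relation.Binary.PropositionalEquality using (_≡_; _≢_)
open import Relation.Nullary using (¬_)

-- A k-ary periodic sequence is modelled as s : ℕ → Fin k (Fin k = ℤ_k),
-- indexed from 0; periodicity / period are stated explicitly.

IsPeriodOf : ∀ {k} → (ℕ → Fin k) → ℕ → Set
IsPeriodOf s q = ∀ i → s (i ℕ.+ q) ≡ s i

HasPeriod : ∀ {k} → (ℕ → Fin k) → ℕ → Set
HasPeriod s p = 0 < p × IsPeriodOf s p × (∀ q → 0 < q → q < p → ¬ IsPeriodOf s q)
  where open import Data.Product using (_×_)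

window : ∀ {k} → (ℕ → Fin k) → (N : ℕ) → ℕ → Vec (Fin k) N
window s N i = tabulate (λ j → s (i ℕ.+ toℕ j))

IsWindowSeq : ∀ {k} → (ℕ → Fin k) → (p N : ℕ) → .{{_ : ℕ.NonZero p}} → Set
IsWindowSeq s p N = ∀ i j → window s N i ≡ window s N j → i % p ≡ j % p

IsOrientable : ∀ {k} → (ℕ → Fin k) → (p N : ℕ) → .{{_ : ℕ.NonZero p}} → Set
IsOrientable s p N =
  IsWindowSeq s p N × (∀ i j → window s N i ≢ reverse (window s N j))
  where open import Data.Product using (_×_)

δ : ℕ → ℕ
δ k with k % 2
... | zero = 2
... | suc _ = 1

-- odd part m of n = 2^t m  (for n ≥ 1); fuel-bounded halving
oddPartAux : ℕ → ℕ → ℕ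
oddPartAux zero n = n
oddPartAux (suc f) zero = zero
oddPartAux (suc f) (suc n) with suc n % 2
... | zero = oddPartAux f (suc n / 2)
... | suc _ = suc n

oddPart : ℕ → ℕ
oddPart n = oddPartAux n n

-- twice s_k(n-1), as an integer (the numerator of the paper's formula).
-- For odd n: (n-1)/2 = n / 2.  For even n: n k^{(n-2)/2}/2 = (n/2) k^{(n/2) - 1}.
twiceS : ℕ → ℕ → ℤ
twiceS k n with n % 2
... | suc _ =
  + (k ℕ.^ n) ℤ.- + δ k ℤ.* (+ n ℤ.* (+ (k ℕ.^ (n / 2)) ℤ.- + 1) ℤ.+ + 1)
... | zero =
  + (k ℕ.^ n)
  ℤ.- + ((n / 2) ℕ.* k ℕ.^ ((n / 2) ∸ 1)) ℤ.* + (δ k ℕ.* δ k ℕ.+ k)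
  ℤ.+ + (n ℕ.* δ k ℕ.* k ℕ.^ ((oddPart n) / 2))
  ℤ.- + (oddPart n ℕ.* δ k) ℤ.* (+ (k ℕ.^ ((oddPart n) / 2)) ℤ.- + 1)
  ℤ.- + δ k

{-# OPTIONS --safe #-}
-- Write −uᴿ for the negated reversal of a word u of length n over ℤ_k.  Among each pair of distinct
-- rotation classes {[u], [−uᴿ]} choose the one with the smaller minimal rotation, in the
-- lexicographic order for an order of the letters with 1 least and −1 greatest.  The chosen words
-- are closed under rotation, and replacing a letter of a chosen word by 1 leaves it chosen.  The
-- words of length n + 1 whose differences are chosen are the edges of a de Bruijn subdigraph.  It
-- carries a lifted rotation, hence a partition into cycles, and every edge is joined to 0 1 2 ⋯ n by
-- repeatedly appending the last letter plus 1; merging the cycles gives an Eulerian circuit.  The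
-- resulting sequence is orientable, since reversing a word negates and reverses its differences.
-- Working with the lifted digraph makes the weight of the difference sequence irrelevant.
--
-- The period is k times the number of chosen words, that is k (k^n − |Sym|) / 2 where Sym consists
-- of the words u with [u] = [−uᴿ].  These are the words p q with p, q antipalindromic (p = −pᴿ),
-- the length of p ranging over 1, …, n.  A power of a shorter word v arises from several of these
-- splittings, so powers are counted through v: with v a letter when n is odd, and with
-- |v| the odd part of n when n is even.
module Submission where

open import Defs

module Construction where

  open import Data.Nat using (ℕ; zero; suc; _+_; _*_; _∸_; _^_; _⊓_; _≤_; _<_; z≤n; s≤s; NonZero; >-nonZero; _%_; _/_; _<?_)
  open import Data.Nat.Properties hiding (_≟_)
  open import Data.Nat.DivMod
  open import Data.Nat.GeneralisedArithmetic using (fold; fold-+)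
  import Data.Nat.Tactic.RingSolver as ℕSolver
  open import Data.Fin using (Fin; zero; suc; toℕ; fromℕ; fromℕ<; combine)
  import Data.Fin.Properties as Finₚ
  open import Data.List as List using (List; []; _∷_; _++_; length; reverse)
  import Data.List.Properties as Listₚ
  open import Data.List.Membership.Propositional using (_∈_)
  open import Data.List.Membership.Propositional.Properties
  open import Data.List.Relation.Unary.Any using (here; there; index)
  open import Data.List.Relation.Unary.Any.Properties using (lookup-index)
  open import Data.List.Relation.Unary.All as All using (All; []; _∷_)
  import Data.List.Relation.Unary.All.Properties as Allₚ
  open import Data.List.Relation.Unary.AllPairs using ([]; _∷_)
  open import Data.List.Relation.Unary.Unique.Propositional using (Unique)
  import Data.List.Relation.Unary.Unique.Propositional.Properties as Uniqueₚ
  open import Data.List.Relation.Binary.Pointwise as Pointwise using (Pointwise; []; _∷_)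
  open import Data.Vec as Vec using (Vec; []; _∷_; _∷ʳ_; toList)
  import Data.Vec.Properties as Vecₚ
  open import Data.Product using (Σ; ∃; ∃₂; _×_; _,_; proj₁; proj₂)
  import Data.Product.Properties as Productₚ
  open import Data.Sum using (_⊎_; inj₁; inj₂)
  open import Data.Empty using (⊥-elim)
  open import Function using (_∘_)
  open import Relation.Nullary using (¬_; Dec; yes; no; ¬?)
  open import Relation.Nullary.Decidable using (map′)
  open import Relation.Unary using (Decidable)
  open import Relation.Binary using (DecidableEquality; tri<; tri≈; tri>)
  open import Relation.Binary.PropositionalEquality

  -- Least witnesses and iteration of a map.

  least : ∀ {P : ℕ → Set} → Decidable P → ∀ n →
          (∃ λ p → P p × (∀ q → q < p → ¬ P q)) ⊎ (∀ q → q < n → ¬ P q)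
  least P? zero = inj₂ λ _ ()
  least P? (suc n) with least P? n
  ... | inj₁ r = inj₁ r
  ... | inj₂ none with P? n
  ...   | yes Pn = inj₁ (n , Pn , none)
  ...   | no ¬Pn = inj₂ λ q q<1+n Pq → case-≤ q q<1+n Pq
    where
    case-≤ : ∀ q → q < suc n → ¬ _
    case-≤ q (s≤s q≤n) Pq with m≤n⇒m<n∨m≡n q≤n
    ... | inj₁ q<n = none q q<n Pq
    ... | inj₂ refl = ¬Pn Pq

  module _ {X : Set} (f : X → X) where

    fold-suc : ∀ x i → fold x f (suc i) ≡ fold (f x) f i
    fold-suc x zero = refl
    fold-suc x (suc i) = cong f (fold-suc x i)

    module _ {x : X} {p : ℕ} (return : fold x f p ≡ x) where

      fold-multiple : ∀ m → fold x f (m * p) ≡ x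
      fold-multiple zero = refl
      fold-multiple (suc m) = trans (fold-+ x f p) (trans (cong (λ y → fold y f p) (fold-multiple m)) return)

      fold-% : .{{_ : NonZero p}} → ∀ i → fold x f i ≡ fold x f (i % p)
      fold-% i = begin
        fold x f i                               ≡⟨ cong (fold x f) (m≡m%n+[m/n]*n i p) ⟩
        fold x f (i % p + i / p * p)             ≡⟨ fold-+ x f (i % p) ⟩
        fold (fold x f (i / p * p)) f (i % p)    ≡⟨ cong (λ y → fold y f (i % p)) (fold-multiple (i / p)) ⟩
        fold x f (i % p)                         ∎
        where open ≡-Reasoning

    -- The total `i * d + i` is a multiple of the return time `suc d`, so iterating forward undoes
    -- `i` steps.
    fold-inverse : ∀ {x d} → fold x f (suc d) ≡ x → ∀ i → fold (fold x f i) f (i * d) ≡ x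
    fold-inverse {x} {d} return i = begin
      fold (fold x f i) f (i * d)   ≡⟨ fold-+ x f (i * d) ⟨
      fold x f (i * d + i)          ≡⟨ cong (fold x f) (trans (+-comm (i * d) i) (sym (*-suc i d))) ⟩
      fold x f (i * suc d)          ≡⟨ fold-multiple return i ⟩
      x                             ∎
      where open ≡-Reasoning

  -- Cycles of a permutation of a finite set, and their merging.

  module Orbit {X : Set} (_≟_ : DecidableEquality X)
               {N : ℕ} (enc : X → Fin N) (enc-injective : ∀ {x y} → enc x ≡ enc y → x ≡ y) where

    Reach : (X → X) → X → X → Set
    Reach f x y = ∃ λ i → fold x f i ≡ y

    Reach-trans : ∀ {f x y z} → Reach f x y → Reach f y z → Reach f x z
    Reach-trans {f} {x} (i , refl) (j , refl) = j + i , fold-+ x f j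

    Reach-step : ∀ {f x y} → Reach f (f x) y → Reach f x y
    Reach-step {f} {x} (i , eq) = suc i , trans (fold-suc f x i) eq

    module _ (f : X → X) (f-injective : ∀ {x y} → f x ≡ f y → x ≡ y) where

      fold-injective : ∀ i {x y} → fold x f i ≡ fold y f i → x ≡ y
      fold-injective zero eq = eq
      fold-injective (suc i) eq = fold-injective i (f-injective eq)

      -- Among `N + 1` iterates two have the same code by the pigeonhole principle; cancelling the
      -- earlier one by injectivity leaves a return to `x`.
      returns : ∀ x → ∃ λ d → fold x f (suc d) ≡ x
      returns x with Finₚ.pigeonhole (n<1+n N) (λ j → enc (fold x f (toℕ j)))
      ... | i , j , i<j , eq = d , sym (fold-injective (toℕ i) (begin
          fold x f (toℕ i)                      ≡⟨ enc-injective eq ⟩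
          fold x f (toℕ j)                      ≡⟨ cong (fold x f) (sym i+1+d≡j) ⟩
          fold x f (toℕ i + suc d)              ≡⟨ fold-+ x f (toℕ i) ⟩
          fold (fold x f (suc d)) f (toℕ i)     ∎))
        where
        open ≡-Reasoning
        d = toℕ j ∸ suc (toℕ i)
        i+1+d≡j : toℕ i + suc d ≡ toℕ j
        i+1+d≡j = trans (+-suc (toℕ i) d) (m+[n∸m]≡n i<j)

      -- This gives the length `suc d` of the cycle through `x`, which becomes the period of the
      -- sequence.
      minimal-return : ∀ x → ∃ λ d → fold x f (suc d) ≡ x × (∀ q → q < d → ¬ fold x f (suc q) ≡ x)
      minimal-return x with least (λ q → fold x f (suc q) ≟ x) (suc (proj₁ (returns x)))
      ... | inj₁ r = r
      ... | inj₂ none = ⊥-elim (none _ (n<1+n _) (proj₂ (returns x)))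

      Reach-sym : ∀ {x y} → Reach f x y → Reach f y x
      Reach-sym {x} (i , refl) with returns x
      ... | d , return = i * d , fold-inverse f return i

      Reach? : ∀ x y → Dec (Reach f x y)
      Reach? x y with returns x
      ... | d , return = map′ (λ { (i , _ , eq) → i , eq })
                              (λ { (i , eq) → i % suc d , m%n<n i (suc d) , trans (sym (fold-% f return i)) eq })
                              (anyUpTo? (λ i → fold x f i ≟ y) (suc d))

      Reach-predecessor : ∀ {x y} → Reach f x y → ∃ λ w → Reach f x w × f w ≡ y
      Reach-predecessor {x} (suc i , eq) = fold x f i , (i , refl) , eq
      Reach-predecessor {x} (zero , refl) with returns x
      ... | d , return = fold x f d , (d , refl) , return

    swap : X → X → X → X
    swap y z x with x ≟ y
    ... | yes _ = z
    ... | no _ with x ≟ z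
    ...   | yes _ = y
    ...   | no _ = x

    swap-left : ∀ y z → swap y z y ≡ z
    swap-left y z with y ≟ y
    ... | yes _ = refl
    ... | no y≢y = ⊥-elim (y≢y refl)

    swap-right : ∀ y z → swap y z z ≡ y
    swap-right y z with z ≟ y
    ... | yes z≡y = z≡y
    ... | no _ with z ≟ z
    ...   | yes _ = refl
    ...   | no z≢z = ⊥-elim (z≢z refl)

    swap-other : ∀ {y z x} → x ≢ y → x ≢ z → swap y z x ≡ x
    swap-other {y} {z} {x} x≢y x≢z with x ≟ y
    ... | yes x≡y = ⊥-elim (x≢y x≡y)
    ... | no _ with x ≟ z
    ...   | yes x≡z = ⊥-elim (x≢z x≡z)
    ...   | no _ = refl

    swap-elim : ∀ (P : X → X → Set) y z → P y z → P z y →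
                (∀ x → x ≢ y → x ≢ z → P x x) → ∀ x → P x (swap y z x)
    swap-elim P y z Pyz Pzy Pxx x with x ≟ y
    ... | yes refl = Pyz
    ... | no x≢y with x ≟ z
    ...   | yes refl = Pzy
    ...   | no x≢z = Pxx x x≢y x≢z

    swap-involutive : ∀ y z x → swap y z (swap y z x) ≡ x
    swap-involutive y z =
      swap-elim (λ x x′ → swap y z x′ ≡ x) y z (swap-right y z) (swap-left y z) (λ _ → swap-other)

    swap-injective : ∀ y z {x x′} → swap y z x ≡ swap y z x′ → x ≡ x′
    swap-injective y z {x} {x′} eq =
      trans (sym (swap-involutive y z x)) (trans (cong (swap y z) eq) (swap-involutive y z x′))

    -- Composing a permutation with a transposition of points of two different cycles merges the cycles.
    module _ (f : X → X) (f-injective : ∀ {x y} → f x ≡ f y → x ≡ y)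
             {e y z : X} (e⇝y : Reach f e y) (e↛z : ¬ Reach f e z) where

      joined : X → X
      joined x = f (swap y z x)

      -- As long as an orbit meets neither `y` nor `z`, `joined` and `f` take the same steps, so the
      -- old route to `z` survives.
      reach-z : ∀ j {x} → fold x f j ≡ z → ¬ Reach f x y → Reach joined x z
      reach-z zero eq _ = zero , eq
      reach-z (suc j) {x} eq x↛y with x ≟ z
      ... | yes x≡z = zero , x≡z
      ... | no x≢z = Reach-step (subst (λ w → Reach joined w z) (cong f (sym (swap-other (λ x≡y → x↛y (zero , x≡y)) x≢z)))
                       (reach-z j (trans (sym (fold-suc f x j)) eq) (λ r → x↛y (Reach-step r))))

      -- `joined` sends `y` to `f z` and then follows the old cycle of `z`, which misses `y`, round
      -- to `z`.
      y⇝z : Reach joined y z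
      y⇝z = Reach-step (subst (λ w → Reach joined (f w) z) (sym (swap-left y z))
              (reach-z (proj₁ fz⇝z) (proj₂ fz⇝z) λ r → e↛z (Reach-trans e⇝y (Reach-sym f f-injective (Reach-step r)))))
        where
        fz⇝z : Reach f (f z) z
        fz⇝z = Reach-sym f f-injective (1 , refl)

      -- Only the step out of `y` is changed; it is replaced by a detour through the cycle of `z`,
      -- after which `joined` sends `z` to `f y`.
      joined-keeps : ∀ i → Reach joined e (fold e f i)
      joined-keeps zero = zero , refl
      joined-keeps (suc i) with fold e f i in eq | joined-keeps i
      ... | x | e⇝x with x ≟ y
      ...   | yes refl = Reach-trans e⇝x (Reach-trans y⇝z (1 , cong f (swap-right y z)))
      ...   | no x≢y = Reach-trans e⇝x (1 , cong f (swap-other x≢y λ x≡z → e↛z (i , trans eq x≡z)))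

      joined-z : Reach joined e z
      joined-z = Reach-trans (subst (Reach joined e) (proj₂ e⇝y) (joined-keeps (proj₁ e⇝y))) y⇝z

    -- Eulerian circuits by merging cycles.

    -- The points of X are the edges of a digraph: x can be followed by x′ when front x′ ≡ rest x.
    module Eulerian {V : Set} (front rest : X → V) (E : X → Set) (e : X) where

      -- On a finite `X` this is a partition of the edges into closed walks, none of which leaves
      -- `E` once it has entered. An Eulerian circuit of `E` is the case of a single cycle holding
      -- all of `E`.
      record IsSuccessor (f : X → X) : Set where
        field
          injective : ∀ {x y} → f x ≡ f y → x ≡ y
          follows   : ∀ x → front (f x) ≡ rest x
          closed    : ∀ {x} → E x → E (f x)

      open IsSuccessor

      -- A certificate that an edge can be brought onto the cycle of `e`: `absorb` works back along
      -- it, beginning at its end `e`.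
      data Path : X → Set where
        here : Path e
        step : ∀ {x x′} → E x → front x′ ≡ rest x → Path x′ → Path x

      module _ (Ee : E e) where

        Reach-closed : ∀ {f} → IsSuccessor f → ∀ {x} → Reach f e x → E x
        Reach-closed {f} S (i , refl) = go i
          where
          go : ∀ i → E (fold e f i)
          go zero = Ee
          go (suc i) = closed S (go i)

        -- Once the next edge `z′` of the path is on the cycle of `e`, its predecessor `y` there
        -- ends at the same vertex as `z`. Exchanging the successors of `y` and `z` therefore
        -- respects adjacency, and it merges the two cycles if they differ.
        absorb : ∀ {z} → Path z → ∀ {f} → IsSuccessor f →
                 ∃ λ f′ → IsSuccessor f′ × (∀ {x} → Reach f e x → Reach f′ e x) × Reach f′ e z
        absorb here {f} S = f , S , (λ r → r) , (zero , refl)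
        absorb (step {z} {z′} Ez z′-follows path) S with absorb path S
        ... | f , S , keeps , e⇝z′ with Reach? f (injective S) e z
        ...   | yes e⇝z = f , S , keeps , e⇝z
        ...   | no e↛z with Reach-predecessor f (injective S) e⇝z′
        ...     | y , e⇝y , fy≡z′ = joined f (injective S) e⇝y e↛z , S′ ,
                  (λ { r → subst (Reach _ e) (proj₂ (keeps r)) (joined-keeps f (injective S) e⇝y e↛z (proj₁ (keeps r))) }) ,
                  joined-z f (injective S) e⇝y e↛z
          where
          rest-y≡rest-z : rest y ≡ rest z
          rest-y≡rest-z = trans (sym (follows S y)) (trans (cong front fy≡z′) z′-follows)
          S′ : IsSuccessor (joined f (injective S) e⇝y e↛z)
          S′ .injective eq = swap-injective y z (injective S eq)
          S′ .follows x = trans (follows S _)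
            (swap-elim (λ x x′ → rest x′ ≡ rest x) y z (sym rest-y≡rest-z) rest-y≡rest-z (λ _ _ _ → refl) x)
          S′ .closed {x} Ex = closed S
            (swap-elim (λ x x′ → E x → E x′) y z (λ _ → Ez) (λ _ → Reach-closed S e⇝y) (λ _ _ _ Ex → Ex) x Ex)

        cover : ∀ {f} → IsSuccessor f → ∀ {zs} → All Path zs →
                ∃ λ f′ → IsSuccessor f′ × All (Reach f′ e) zs
        cover {f} S [] = f , S , []
        cover S (path ∷ paths) with cover S paths
        ... | f , S , e⇝zs with absorb path S
        ...   | f′ , S′ , keeps , e⇝z = f′ , S′ , e⇝z ∷ All.map keeps e⇝zs

  -- Rotations of words.

  ++-injective : ∀ {A : Set} (as bs : List A) {cs ds} →
                 length as ≡ length bs → as ++ cs ≡ bs ++ ds → as ≡ bs × cs ≡ ds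
  ++-injective [] [] _ eq = refl , eq
  ++-injective (a ∷ as) (b ∷ bs) len eq with Listₚ.∷-injective eq
  ... | refl , eq′ with ++-injective as bs (suc-injective len) eq′
  ...   | refl , eq″ = refl , eq″

  rotate : ∀ {A : Set} → List A → List A
  rotate [] = []
  rotate (a ∷ u) = u ++ a ∷ []

  length-rotate : ∀ {A : Set} (u : List A) → length (rotate u) ≡ length u
  length-rotate [] = refl
  length-rotate (a ∷ u) = trans (Listₚ.length-++ u) (+-comm (length u) 1)

  length-rotations : ∀ {A : Set} (u : List A) i → length (fold u rotate i) ≡ length u
  length-rotations u zero = refl
  length-rotations u (suc i) = trans (length-rotate (fold u rotate i)) (length-rotations u i)

  rotate-prefix : ∀ {A : Set} (p q : List A) → fold (p ++ q) rotate (length p) ≡ q ++ p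
  rotate-prefix [] q = sym (Listₚ.++-identityʳ q)
  rotate-prefix (a ∷ p) q = begin
    fold (a ∷ p ++ q) rotate (suc (length p))      ≡⟨ fold-suc rotate (a ∷ p ++ q) (length p) ⟩
    fold ((p ++ q) ++ a ∷ []) rotate (length p)    ≡⟨ cong (λ w → fold w rotate (length p)) (Listₚ.++-assoc p q _) ⟩
    fold (p ++ q ++ a ∷ []) rotate (length p)      ≡⟨ rotate-prefix p (q ++ a ∷ []) ⟩
    (q ++ a ∷ []) ++ p                             ≡⟨ Listₚ.++-assoc q _ p ⟩
    q ++ a ∷ p                                     ∎
    where open ≡-Reasoning

  rotate-length : ∀ {A : Set} (u : List A) → fold u rotate (length u) ≡ u
  rotate-length u = subst (λ w → fold w rotate (length u) ≡ u) (Listₚ.++-identityʳ u) (rotate-prefix u [])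

  rotations-split : ∀ {A : Set} (u : List A) i → ∃₂ λ p q → u ≡ p ++ q × fold u rotate i ≡ q ++ p
  rotations-split u zero = [] , u , refl , sym (Listₚ.++-identityʳ u)
  rotations-split u (suc i) with rotations-split u i
  ... | p , a ∷ q , refl , eq = p ++ a ∷ [] , q , sym (Listₚ.++-assoc p _ q) ,
        trans (cong rotate eq) (Listₚ.++-assoc q p _)
  ... | [] , [] , refl , eq = [] , [] , refl , cong rotate eq
  ... | a ∷ p , [] , refl , eq = a ∷ [] , p , cong (a ∷_) (Listₚ.++-identityʳ p) , cong rotate eq

  rotations-bounded : ∀ {A : Set} (u : List A) j → ∃ λ i → i ≤ length u × fold u rotate j ≡ fold u rotate i
  rotations-bounded u zero = 0 , z≤n , refl
  rotations-bounded [] (suc j) with rotations-bounded [] j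
  ... | zero , i≤ , eq = 0 , z≤n , cong rotate eq
  rotations-bounded u@(_ ∷ _) (suc j) with rotations-bounded u j
  ... | i , i≤ , eq with m≤n⇒m<n∨m≡n i≤
  ...   | inj₁ i< = suc i , i< , cong rotate eq
  -- After a full turn the word is `u` again, so the next rotation is the first one.
  ...   | inj₂ refl = 1 , s≤s z≤n , cong rotate (trans eq (rotate-length u))

  rotate-predecessor : ∀ {A : Set} (u : List A) j → ∃ λ i → fold u rotate j ≡ fold (rotate u) rotate i
  rotate-predecessor u (suc j) = j , fold-suc rotate u j
  rotate-predecessor [] zero = 0 , refl
  rotate-predecessor u@(_ ∷ v) zero = length v , trans (sym (rotate-length u)) (fold-suc rotate u (length v))

  rotations-inverse : ∀ {A : Set} (u : List A) i → ∃ λ j → fold (fold u rotate i) rotate j ≡ u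
  rotations-inverse [] i = 0 , fixed i
    where
    fixed : ∀ i → fold [] rotate i ≡ []
    fixed zero = refl
    fixed (suc i) = cong rotate (fixed i)
  rotations-inverse u@(_ ∷ v) i = i * length v , fold-inverse rotate (rotate-length u) i

  -- Arithmetic modulo `k` and negated reversal.

  module Residues (k-1 : ℕ) where

    private k = suc k-1

    infixl 6 _⊕_
    _⊕_ : Fin k → Fin k → Fin k
    x ⊕ y = (toℕ x + toℕ y) mod k

    ⊖_ : Fin k → Fin k
    ⊖ x = (k ∸ toℕ x) mod k

    toℕ-mod : ∀ m → toℕ (m mod k) ≡ m % k
    toℕ-mod m = Finₚ.toℕ-fromℕ< _

    toℕ-% : ∀ (x : Fin k) → toℕ x % k ≡ toℕ x
    toℕ-% x = m<n⇒m%n≡m (Finₚ.toℕ<n x)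

    ⊕-comm : ∀ x y → x ⊕ y ≡ y ⊕ x
    ⊕-comm x y = cong (_mod k) (+-comm (toℕ x) (toℕ y))

    ⊕-⊖-cancel : ∀ c a → (c ⊕ a) ⊕ (⊖ a) ≡ c
    ⊕-⊖-cancel c a = Finₚ.toℕ-injective (begin
      toℕ ((c ⊕ a) ⊕ (⊖ a))                           ≡⟨ toℕ-mod (toℕ (c ⊕ a) + toℕ (⊖ a)) ⟩
      (toℕ (c ⊕ a) + toℕ (⊖ a)) % k                   ≡⟨ cong₂ (λ x y → (x + y) % k) (toℕ-mod (toℕ c + toℕ a)) (toℕ-mod (k ∸ toℕ a)) ⟩
      ((toℕ c + toℕ a) % k + (k ∸ toℕ a) % k) % k     ≡⟨ %-distribˡ-+ (toℕ c + toℕ a) (k ∸ toℕ a) k ⟨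
      (toℕ c + toℕ a + (k ∸ toℕ a)) % k               ≡⟨ cong (_% k) (+-assoc (toℕ c) (toℕ a) _) ⟩
      (toℕ c + (toℕ a + (k ∸ toℕ a))) % k             ≡⟨ cong (λ m → (toℕ c + m) % k) (m+[n∸m]≡n (<⇒≤ (Finₚ.toℕ<n a))) ⟩
      (toℕ c + k) % k                                 ≡⟨ [m+n]%n≡m%n (toℕ c) k ⟩
      toℕ c % k                                       ≡⟨ toℕ-% c ⟩
      toℕ c                                           ∎)
      where open ≡-Reasoning

    ⊕-cancelʳ : ∀ {a c d} → c ⊕ a ≡ d ⊕ a → c ≡ d
    ⊕-cancelʳ {a} {c} {d} eq = trans (sym (⊕-⊖-cancel c a)) (trans (cong (_⊕ (⊖ a)) eq) (⊕-⊖-cancel d a))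

    ⊕-cancelˡ : ∀ {c a b} → c ⊕ a ≡ c ⊕ b → a ≡ b
    ⊕-cancelˡ {c} {a} {b} eq = ⊕-cancelʳ (trans (⊕-comm a c) (trans eq (⊕-comm c b)))

    0⊕ : ∀ x → zero ⊕ x ≡ x
    0⊕ x = Finₚ.toℕ-injective (trans (toℕ-mod (toℕ x)) (toℕ-% x))

    ⊕-⊖ : ∀ a → a ⊕ (⊖ a) ≡ zero
    ⊕-⊖ a = trans (cong (_⊕ (⊖ a)) (sym (0⊕ a))) (⊕-⊖-cancel zero a)

    ⊖-involutive : ∀ a → ⊖ ⊖ a ≡ a
    ⊖-involutive a = ⊕-cancelˡ {⊖ a} (trans (⊕-⊖ (⊖ a)) (trans (sym (⊕-⊖ a)) (⊕-comm a (⊖ a))))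

    -- The solutions of -c = c, namely 0 and, for even `k`, also k/2. Their number is the meaning of
    -- `δ k`.
    self-negative : List (Fin k)
    self-negative with k % 2
    ... | zero = zero ∷ (k / 2) mod k ∷ []
    ... | suc _ = zero ∷ []

    length-self-negative : length self-negative ≡ δ k
    length-self-negative with k % 2
    ... | zero = refl
    ... | suc _ = refl

    ⊖zero : ⊖ zero ≡ zero
    ⊖zero = Finₚ.toℕ-injective (trans (toℕ-mod k) (n%n≡0 k))

    half : ∀ h → k ≡ h + h → 0 < h × h < k
    half zero ()
    half (suc h) eq = s≤s z≤n , subst (suc h <_) (sym eq) (m<m+n (suc h) (s≤s z≤n))

    double-half : k % 2 ≡ 0 → k ≡ k / 2 + k / 2
    double-half even = trans (m≡m%n+[m/n]*n k 2) (trans (cong (_+ k / 2 * 2) even)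
      (trans (*-comm (k / 2) 2) (cong (k / 2 +_) (+-identityʳ (k / 2)))))

    self-negative-unique : Unique self-negative
    self-negative-unique with k % 2 in eq
    ... | suc _ = [] ∷ []
    ... | zero = (zero≢ ∷ []) ∷ [] ∷ []
      where
      0<h = proj₁ (half (k / 2) (double-half eq))
      h<k = proj₂ (half (k / 2) (double-half eq))
      zero≢ : zero ≢ (k / 2) mod k
      zero≢ 0≡h = <⇒≢ 0<h (trans (cong toℕ 0≡h) (trans (toℕ-mod (k / 2)) (m<n⇒m%n≡m h<k)))

    self-negative-sound : ∀ {c} → c ∈ self-negative → ⊖ c ≡ c
    self-negative-sound c∈ with k % 2 in eq
    self-negative-sound (here refl) | suc _ = ⊖zero
    self-negative-sound (here refl) | zero = ⊖zero
    self-negative-sound (there (here refl)) | zero = Finₚ.toℕ-injective (begin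
      toℕ (⊖ h)                                  ≡⟨ toℕ-mod (k ∸ toℕ h) ⟩
      (k ∸ toℕ h) % k                            ≡⟨ cong (λ m → (k ∸ m) % k) toℕ-h ⟩
      (k ∸ k / 2) % k                            ≡⟨ cong (λ m → (m ∸ k / 2) % k) (double-half eq) ⟩
      (k / 2 + k / 2 ∸ k / 2) % k                ≡⟨ cong (_% k) (m+n∸n≡m (k / 2) (k / 2)) ⟩
      (k / 2) % k                                ≡⟨ toℕ-mod (k / 2) ⟨
      toℕ h                                      ∎)
      where
      open ≡-Reasoning
      h = (k / 2) mod k
      toℕ-h : toℕ h ≡ k / 2
      toℕ-h = trans (toℕ-mod (k / 2)) (m<n⇒m%n≡m (proj₂ (half (k / 2) (double-half eq))))

    -- For a positive residue the reduction modulo `k` in `⊖` changes nothing, so the equation holds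
    -- between natural numbers.
    self-negative-double : ∀ c′ → ⊖ (suc c′) ≡ suc c′ → k ≡ toℕ (suc c′) + toℕ (suc c′)
    self-negative-double c′ eq = trans (sym (m+[n∸m]≡n (<⇒≤ (Finₚ.toℕ<n (suc c′)))))
      (cong (toℕ (suc c′) +_) (begin
        k ∸ suc (toℕ c′)               ≡⟨ m<n⇒m%n≡m (s≤s (m∸n≤m k-1 (toℕ c′))) ⟨
        (k ∸ suc (toℕ c′)) % k         ≡⟨ toℕ-mod (k ∸ suc (toℕ c′)) ⟨
        toℕ (⊖ (suc c′))               ≡⟨ cong toℕ eq ⟩
        toℕ (suc c′)                   ∎))
      where open ≡-Reasoning

    self-negative-complete : ∀ c → ⊖ c ≡ c → c ∈ self-negative
    self-negative-complete c c-self with k % 2 in eq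
    self-negative-complete zero c-self | zero = here refl
    self-negative-complete zero c-self | suc _ = here refl
    self-negative-complete (suc c′) c-self | zero = there (here (Finₚ.toℕ-injective (begin
      c                       ≡⟨ m<n⇒m%n≡m (Finₚ.toℕ<n (suc c′)) ⟨
      c % k                   ≡⟨ cong (_% k) (m*n/n≡m c 2) ⟨
      (c * 2 / 2) % k         ≡⟨ cong (λ m → (m / 2) % k) (trans (*-comm c 2) (cong (c +_) (+-identityʳ c))) ⟩
      ((c + c) / 2) % k       ≡⟨ cong (λ m → (m / 2) % k) (self-negative-double c′ c-self) ⟨
      (k / 2) % k             ≡⟨ toℕ-mod (k / 2) ⟨
      toℕ ((k / 2) mod k)     ∎)))
      where
      open ≡-Reasoning
      c = toℕ (suc c′)
    self-negative-complete (suc c′) c-self | suc r = ⊥-elim (0≢1+n (begin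
      0                       ≡⟨ m*n%n≡0 c 2 ⟨
      (c * 2) % 2             ≡⟨ cong (_% 2) (trans (*-comm c 2) (cong (c +_) (+-identityʳ c))) ⟩
      (c + c) % 2             ≡⟨ cong (_% 2) (self-negative-double c′ c-self) ⟨
      k % 2                   ≡⟨ eq ⟩
      suc r                   ∎))
      where
      open ≡-Reasoning
      c = toℕ (suc c′)

    nr : List (Fin k) → List (Fin k)
    nr u = reverse (List.map ⊖_ u)

    nr-++ : ∀ u v → nr (u ++ v) ≡ nr v ++ nr u
    nr-++ u v = trans (cong reverse (Listₚ.map-++ ⊖_ u v)) (Listₚ.reverse-++ (List.map ⊖_ u) _)

    length-nr : ∀ u → length (nr u) ≡ length u
    length-nr u = trans (Listₚ.length-reverse (List.map ⊖_ u)) (Listₚ.length-map ⊖_ u)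

    nr-involutive : ∀ u → nr (nr u) ≡ u
    nr-involutive u = begin
      reverse (List.map ⊖_ (reverse (List.map ⊖_ u)))   ≡⟨ cong reverse (Listₚ.reverse-map ⊖_ (List.map ⊖_ u)) ⟩
      reverse (reverse (List.map ⊖_ (List.map ⊖_ u)))   ≡⟨ Listₚ.reverse-involutive _ ⟩
      List.map ⊖_ (List.map ⊖_ u)                       ≡⟨ Listₚ.map-∘ u ⟨
      List.map (λ a → ⊖ ⊖ a) u                          ≡⟨ Listₚ.map-cong ⊖-involutive u ⟩
      List.map (λ a → a) u                              ≡⟨ Listₚ.map-id u ⟩
      u                                                 ∎
      where open ≡-Reasoning

    -- Negated reversal conjugates rotation into its inverse, hence it carries rotation classes to
    -- rotation classes.
    rotate-nr-rotate : ∀ u → rotate (nr (rotate u)) ≡ nr u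
    rotate-nr-rotate [] = refl
    rotate-nr-rotate (a ∷ v) = begin
      rotate (nr (v ++ a ∷ []))     ≡⟨ cong rotate (nr-++ v (a ∷ [])) ⟩
      nr v ++ (⊖ a) ∷ []            ≡⟨ nr-++ (a ∷ []) v ⟨
      nr (a ∷ v)                    ∎
      where open ≡-Reasoning

    AntiPalindrome : List (Fin k) → Set
    AntiPalindrome u = nr u ≡ u

    -- The words whose class under rotation is closed under negated reversal.
    Symmetric : List (Fin k) → Set
    Symmetric u = ∃₂ λ p q → u ≡ p ++ q × AntiPalindrome p × AntiPalindrome q

  -- The choice of words up to negated reversal.

  -- One representative of every pair of rotation classes of a word and its negated reversal.
  module Orientation (k-3 : ℕ) where

    private k = 3 + k-3
    open Residues (2 + k-3) public

    one : Fin k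
    one = suc zero

    -- The transposition of 0 and 1; all that matters is that 1 comes first and −1 = k − 1 last.
    rank : Fin k → ℕ
    rank zero = 1
    rank (suc zero) = 0
    rank (suc (suc i)) = 2 + toℕ i

    rank<k : ∀ a → rank a < k
    rank<k zero = s≤s (s≤s z≤n)
    rank<k (suc zero) = s≤s z≤n
    rank<k (suc (suc i)) = s≤s (s≤s (Finₚ.toℕ<n i))

    rank-injective : ∀ {a b} → rank a ≡ rank b → a ≡ b
    rank-injective {zero} {zero} eq = refl
    rank-injective {zero} {suc (suc b)} ()
    rank-injective {suc zero} {suc zero} eq = refl
    rank-injective {suc (suc a)} {zero} ()
    rank-injective {suc (suc a)} {suc (suc b)} eq = cong (λ c → suc (suc c)) (Finₚ.toℕ-injective (suc-injective (suc-injective eq)))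

    ⊖one : ⊖ one ≡ suc (suc (fromℕ k-3))
    ⊖one = Finₚ.toℕ-injective (trans (toℕ-mod (2 + k-3)) (trans (m<n⇒m%n≡m (n<1+n (2 + k-3)))
             (cong (2 +_) (sym (Finₚ.toℕ-fromℕ k-3)))))

    -- With at least three letters -1 is not 1; this is what makes the word of ones chosen.
    one≢⊖one : one ≢ ⊖ one
    one≢⊖one eq with trans eq ⊖one
    ... | ()

    rank-⊖one-maximal : ∀ a → rank a ≤ rank (⊖ one)
    rank-⊖one-maximal a rewrite ⊖one | Finₚ.toℕ-fromℕ k-3 with rank<k a
    ... | s≤s le = le

    infix 4 _≼_
    -- The second condition makes negation order-reversing, so that lowering a letter lowers a word
    -- and raises its negated reversal at the same time.
    _≼_ : Fin k → Fin k → Set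
    a ≼ b = rank a ≤ rank b × rank (⊖ b) ≤ rank (⊖ a)

    ≼-refl : ∀ {a} → a ≼ a
    ≼-refl = ≤-refl , ≤-refl

    one-≼ : ∀ a → one ≼ a
    one-≼ a = z≤n , rank-⊖one-maximal (⊖ a)

    ⊖-antitone : ∀ a b → a ≼ b → ⊖ b ≼ ⊖ a
    ⊖-antitone a b (le , ⊖le) = ⊖le , subst₂ (λ x y → rank x ≤ rank y) (sym (⊖-involutive a)) (sym (⊖-involutive b)) le

    infix 4 _≼*_
    _≼*_ : List (Fin k) → List (Fin k) → Set
    _≼*_ = Pointwise _≼_

    ≼*-rotate : ∀ {u v} → u ≼* v → rotate u ≼* rotate v
    ≼*-rotate [] = []
    ≼*-rotate (le ∷ les) = Pointwise.++⁺ les (le ∷ [])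

    ≼*-rotations : ∀ {u v} i → u ≼* v → fold u rotate i ≼* fold v rotate i
    ≼*-rotations zero le = le
    ≼*-rotations (suc i) le = ≼*-rotate (≼*-rotations i le)

    nr-antitone : ∀ {u v} → u ≼* v → nr v ≼* nr u
    nr-antitone le = Pointwise.reverse⁺ (map-⊖ le)
      where
      map-⊖ : ∀ {u v} → u ≼* v → List.map ⊖_ v ≼* List.map ⊖_ u
      map-⊖ [] = []
      map-⊖ (_∷_ {x = a} {y = b} le les) = ⊖-antitone a b le ∷ map-⊖ les

    -- A base-`k` number with the first letter as least significant digit: words of one length are
    -- compared lexicographically from their last letter.
    code : List (Fin k) → ℕ
    code [] = 0
    code (a ∷ u) = rank a + code u * k

    code-mono : ∀ {u v} → u ≼* v → code u ≤ code v
    code-mono [] = z≤n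
    code-mono ((le , _) ∷ les) = +-mono-≤ le (*-monoˡ-≤ k (code-mono les))

    code-injective : ∀ u v → length u ≡ length v → code u ≡ code v → u ≡ v
    code-injective [] [] _ _ = refl
    code-injective (a ∷ u) (b ∷ v) len eq = cong₂ _∷_ (rank-injective ra≡rb)
      (code-injective u v (suc-injective len)
        (*-cancelʳ-≡ (code u) (code v) k (+-cancelˡ-≡ (rank a) _ _ (trans eq (cong (_+ code v * k) (sym ra≡rb))))))
      where
      open ≡-Reasoning
      ra≡rb : rank a ≡ rank b
      ra≡rb = begin
        rank a                      ≡⟨ m<n⇒m%n≡m (rank<k a) ⟨
        rank a % k                  ≡⟨ [m+kn]%n≡m%n (rank a) (code u) k ⟨
        (rank a + code u * k) % k   ≡⟨ cong (_% k) eq ⟩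
        (rank b + code v * k) % k   ≡⟨ [m+kn]%n≡m%n (rank b) (code v) k ⟩
        rank b % k                  ≡⟨ m<n⇒m%n≡m (rank<k b) ⟩
        rank b                      ∎

    minUpTo : (ℕ → ℕ) → ℕ → ℕ
    minUpTo g zero = g zero
    minUpTo g (suc i) = g (suc i) ⊓ minUpTo g i

    minUpTo-attained : ∀ g i → ∃ λ j → minUpTo g i ≡ g j
    minUpTo-attained g zero = 0 , refl
    minUpTo-attained g (suc i) with ⊓-sel (g (suc i)) (minUpTo g i)
    ... | inj₁ eq = suc i , eq
    ... | inj₂ eq = proj₁ (minUpTo-attained g i) , trans eq (proj₂ (minUpTo-attained g i))

    minUpTo-≤ : ∀ g {i j} → j ≤ i → minUpTo g i ≤ g j
    minUpTo-≤ g {zero} {zero} z≤n = ≤-refl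
    minUpTo-≤ g {suc i} {j} j≤ with m≤n⇒m<n∨m≡n j≤
    ... | inj₁ (s≤s j≤i) = ≤-trans (m⊓n≤n (g (suc i)) _) (minUpTo-≤ g j≤i)
    ... | inj₂ refl = m⊓n≤m (g (suc i)) _

    -- The code of the least rotation, an invariant of the rotation class. The index `length u` only
    -- repeats the rotation by 0.
    necklace : List (Fin k) → ℕ
    necklace u = minUpTo (λ i → code (fold u rotate i)) (length u)

    necklace-attained : ∀ u → ∃ λ i → necklace u ≡ code (fold u rotate i)
    necklace-attained u = minUpTo-attained _ (length u)

    necklace-≤ : ∀ u j → necklace u ≤ code (fold u rotate j)
    necklace-≤ u j with rotations-bounded u j
    ... | i , i≤ , eq rewrite eq = minUpTo-≤ _ i≤

    -- The rotation that is least for `v` lies letterwise above the same rotation of `u`.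
    necklace-mono : ∀ {u v} → u ≼* v → necklace u ≤ necklace v
    necklace-mono {u} {v} le with necklace-attained v
    ... | i , eq = subst (necklace u ≤_) (sym eq) (≤-trans (necklace-≤ u i) (code-mono (≼*-rotations i le)))

    necklace-rotate : ∀ u → necklace (rotate u) ≡ necklace u
    necklace-rotate u = ≤-antisym rotate≤ ≤rotate
      where
      rotate≤ : necklace (rotate u) ≤ necklace u
      rotate≤ with necklace-attained u
      ... | j , eq with rotate-predecessor u j
      ...   | i , eq′ = subst (necklace (rotate u) ≤_) (sym (trans eq (cong code eq′))) (necklace-≤ (rotate u) i)
      ≤rotate : necklace u ≤ necklace (rotate u)
      ≤rotate with necklace-attained (rotate u)
      ... | j , eq = subst (necklace u ≤_) (sym (trans eq (cong code (sym (fold-suc rotate u j))))) (necklace-≤ u (suc j))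

    -- Strictness rejects both `u` and `nr u` when their rotation classes coincide.
    Chosen : List (Fin k) → Set
    Chosen u = necklace u < necklace (nr u)

    Chosen? : Decidable Chosen
    Chosen? u = necklace u <? necklace (nr u)

    Chosen-rotate : ∀ u → Chosen u → Chosen (rotate u)
    Chosen-rotate u = subst₂ _<_ (sym (necklace-rotate u))
      (trans (cong necklace (sym (rotate-nr-rotate u))) (necklace-rotate (nr (rotate u))))

    Chosen-≼* : ∀ u v → u ≼* v → Chosen v → Chosen u
    Chosen-≼* u v le ch = ≤-<-trans (necklace-mono le) (<-≤-trans ch (necklace-mono (nr-antitone le)))

    Chosen-one : ∀ a v → Chosen (a ∷ v) → Chosen (one ∷ v)
    Chosen-one a v = Chosen-≼* (one ∷ v) (a ∷ v) (one-≼ a ∷ Pointwise.refl (λ {b} → ≼-refl {b}))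

    ¬Chosen-both : ∀ u → Chosen u → ¬ Chosen (nr u)
    ¬Chosen-both u ch ch′ = <-asym ch (subst (λ w → necklace (nr u) < necklace w) (nr-involutive u) ch′)

    -- Equal minima mean that the two least rotations are the same word, since codes are injective
    -- on words of one length; undoing the rotation of `v` finishes.
    necklace-conjugate : ∀ u v → length u ≡ length v → necklace u ≡ necklace v → ∃ λ i → v ≡ fold u rotate i
    necklace-conjugate u v len eq with necklace-attained u | necklace-attained v
    ... | i , eqᵤ | j , eqᵥ with rotations-inverse v j
    ...   | l , inverse = l + i , sym (begin
            fold u rotate (l + i)                   ≡⟨ fold-+ u rotate l ⟩
            fold (fold u rotate i) rotate l         ≡⟨ cong (λ w → fold w rotate l) same ⟩
            fold (fold v rotate j) rotate l         ≡⟨ inverse ⟩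
            v                                       ∎)
      where
      open ≡-Reasoning
      same : fold u rotate i ≡ fold v rotate j
      same = code-injective _ _ (trans (length-rotations u i) (trans len (sym (length-rotations v j))))
               (trans (sym eqᵤ) (trans eq eqᵥ))

    -- If the two minima agree, then `nr u` is a rotation `q ++ p` of `u = p ++ q`. It is also
    -- `nr q ++ nr p`, and comparing prefixes of equal length shows both parts antipalindromic.
    Chosen-or-Symmetric : ∀ u → Chosen u ⊎ Chosen (nr u) ⊎ Symmetric u
    Chosen-or-Symmetric u with <-cmp (necklace u) (necklace (nr u))
    ... | tri< lt _ _ = inj₁ lt
    ... | tri> _ _ gt = inj₂ (inj₁ (subst (λ w → necklace (nr u) < necklace w) (sym (nr-involutive u)) gt))
    ... | tri≈ _ eq _ with necklace-conjugate u (nr u) (sym (length-nr u)) eq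
    ...   | i , conj with rotations-split u i
    ...     | p , q , refl , eq′ = inj₂ (inj₂ (p , q , refl , proj₂ parts , proj₁ parts))
      where
      parts : nr q ≡ q × nr p ≡ p
      parts = ++-injective (nr q) q (length-nr q) (trans (sym (nr-++ p q)) (trans conj eq′))

    ones : ℕ → List (Fin k)
    ones n = List.replicate n one

    code-ones : ∀ n → code (ones n) ≡ 0
    code-ones zero = refl
    code-ones (suc n) = cong (_* k) (code-ones n)

    All-rotate : ∀ {P : Fin k → Set} i {u} → All P u → All P (fold u rotate i)
    All-rotate zero ps = ps
    All-rotate {P} (suc i) {u} ps = go (All-rotate i ps)
      where
      go : ∀ {u} → All P u → All P (rotate u)
      go [] = []
      go (p ∷ ps) = Allₚ.++⁺ ps (p ∷ [])

    -- The word of ones has code 0. Were it not chosen, some rotation of the word with all letters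
    -- -1 would also have code 0 and so consist of ones.
    Chosen-ones : ∀ n → Chosen (ones (suc n))
    Chosen-ones n with necklace (ones (suc n)) <? necklace (nr (ones (suc n)))
    ... | yes ch = ch
    ... | no ¬ch with necklace-attained (nr (ones (suc n)))
    ...   | i , eq = ⊥-elim (one≢⊖one (first (subst (All (_≡ ⊖ one)) same (All-rotate i (nr-ones (suc n))))))
      where
      first : All (_≡ ⊖ one) (ones (suc n)) → one ≡ ⊖ one
      first (eq ∷ _) = eq
      nr-ones : ∀ n → All (_≡ ⊖ one) (nr (ones n))
      nr-ones zero = []
      nr-ones (suc n) = subst (All (_≡ ⊖ one)) (sym (nr-++ (one ∷ []) (ones n))) (Allₚ.++⁺ (nr-ones n) (refl ∷ []))
      necklace-0 : necklace (nr (ones (suc n))) ≡ 0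
      necklace-0 = n≤0⇒n≡0 (≤-trans (≮⇒≥ ¬ch) (subst (necklace (ones (suc n)) ≤_) (code-ones (suc n)) (necklace-≤ (ones (suc n)) 0)))
      same : fold (nr (ones (suc n))) rotate i ≡ ones (suc n)
      same = code-injective _ _ (trans (length-rotations (nr (ones (suc n))) i) (length-nr (ones (suc n))))
               (trans (sym eq) (trans necklace-0 (sym (code-ones (suc n)))))

  -- Counting with duplicate-free lists, and enumeration of words.

  lookup-injective : ∀ {A : Set} {xs : List A} → Unique xs → ∀ i j → List.lookup xs i ≡ List.lookup xs j → i ≡ j
  lookup-injective (_ ∷ _) zero zero _ = refl
  lookup-injective (x∉ ∷ _) zero (suc j) eq = ⊥-elim (All.lookup x∉ (∈-lookup j) eq)
  lookup-injective (x∉ ∷ _) (suc i) zero eq = ⊥-elim (All.lookup x∉ (∈-lookup i) (sym eq))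
  lookup-injective (_ ∷ unique) (suc i) (suc j) eq = cong suc (lookup-injective unique i j eq)

  length-≤-⊆ : ∀ {A : Set} {xs ys : List A} → Unique xs → (∀ {x} → x ∈ xs → x ∈ ys) → length xs ≤ length ys
  length-≤-⊆ {xs = xs} {ys} unique xs⊆ys = Finₚ.injective⇒≤ {f = λ i → index (position i)} λ {i} {j} eq →
    lookup-injective unique i j (trans (lookup-index (position i)) (trans (cong (List.lookup ys) eq) (sym (lookup-index (position j)))))
    where
    position : ∀ i → List.lookup xs i ∈ ys
    position i = xs⊆ys (∈-lookup i)

  toList-injective : ∀ {A : Set} {n} {u v : Vec A n} → toList u ≡ toList v → u ≡ v
  toList-injective {u = u} {v} eq = trans (sym (Vecₚ.cast-is-id refl u)) (Vecₚ.toList-injective refl u v eq)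

  length-cartesianProductWith : ∀ {A B C : Set} (g : A → B → C) xs ys →
    length (List.cartesianProductWith g xs ys) ≡ length xs * length ys
  length-cartesianProductWith g [] ys = refl
  length-cartesianProductWith g (x ∷ xs) ys = trans (Listₚ.length-++ (List.map (g x) ys))
    (cong₂ _+_ (Listₚ.length-map (g x) ys) (length-cartesianProductWith g xs ys))

  length-allFin : ∀ n → length (List.allFin n) ≡ n
  length-allFin n = Listₚ.length-tabulate {n = n} (λ i → i)

  allVecs : ∀ k n → List (Vec (Fin k) n)
  allVecs k zero = [] ∷ []
  allVecs k (suc n) = List.cartesianProductWith _∷_ (List.allFin k) (allVecs k n)

  length-allVecs : ∀ k n → length (allVecs k n) ≡ k ^ n
  length-allVecs k zero = refl
  length-allVecs k (suc n) = trans (length-cartesianProductWith _∷_ (List.allFin k) (allVecs k n))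
    (cong₂ _*_ (length-allFin k) (length-allVecs k n))

  allVecs-unique : ∀ k n → Unique (allVecs k n)
  allVecs-unique k zero = [] ∷ []
  allVecs-unique k (suc n) = Uniqueₚ.cartesianProductWith⁺ _∷_ Vecₚ.∷-injective (Uniqueₚ.allFin⁺ k) (allVecs-unique k n)

  ∈-allVecs : ∀ {k n} (v : Vec (Fin k) n) → v ∈ allVecs k n
  ∈-allVecs [] = here refl
  ∈-allVecs (a ∷ v) = ∈-cartesianProductWith⁺ _∷_ (∈-allFin a) (∈-allVecs v)

  encode : ∀ {k n} → Vec (Fin k) n → Fin (k ^ n)
  encode [] = zero
  encode (a ∷ v) = combine a (encode v)

  encode-injective : ∀ {k n} (u v : Vec (Fin k) n) → encode u ≡ encode v → u ≡ v
  encode-injective [] [] _ = refl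
  encode-injective (a ∷ u) (b ∷ v) eq with Finₚ.combine-injective a (encode u) b (encode v) eq
  ... | a≡b , eq′ = cong₂ _∷_ a≡b (encode-injective u v eq′)

  infix 4 _⊑_
  -- The prefix relation with both lengths as indices, so that a prefix may shrink while the word it
  -- is compared with keeps its length.
  data _⊑_ {A : Set} : ∀ {m n} → Vec A m → Vec A n → Set where
    []  : ∀ {n} {v : Vec A n} → [] ⊑ v
    _∷_ : ∀ {m n} a {w : Vec A m} {v : Vec A n} → w ⊑ v → (a ∷ w) ⊑ (a ∷ v)

  ⊑-refl : ∀ {A : Set} {n} (v : Vec A n) → v ⊑ v
  ⊑-refl [] = []
  ⊑-refl (a ∷ v) = a ∷ ⊑-refl v

  ⊑-∷ʳ : ∀ {A : Set} {m n} {w : Vec A m} {v : Vec A n} {b} → w ⊑ v → w ⊑ v ∷ʳ b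
  ⊑-∷ʳ [] = []
  ⊑-∷ʳ (a ∷ p) = a ∷ ⊑-∷ʳ p

  ⊑-init : ∀ {A : Set} {m n} {w : Vec A m} (v : Vec A (suc n)) → w ⊑ Vec.init v → w ⊑ v
  ⊑-init v p = subst (_ ⊑_) (sym (proj₂ (proj₂ (Vec.initLast v)))) (⊑-∷ʳ p)

  -- The lifted digraph and its connectedness.

  -- The pair (c , d) of a letter and a word of length n stands for the word of length n + 1 with
  -- first letter c and successive differences d, so the lifts of the chosen words are the pairs
  -- with d chosen.
  module Lift (k-3 n-1 : ℕ) where

    private
      k = 3 + k-3
      n = suc n-1
    open Orientation k-3

    Edge Vertex : Set
    Edge = Fin k × Vec (Fin k) n
    Vertex = Fin k × Vec (Fin k) n-1

    -- A vertex is a word of length `n`, again given by first letter and differences: `front` drops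
    -- the last letter of the edge, `rest` the first.
    front rest : Edge → Vertex
    front (c , d) = c , Vec.init d
    rest (c , a ∷ v) = c ⊕ a , v

    ChosenEdge : Edge → Set
    ChosenEdge (c , d) = Chosen (toList d)

    shift : Fin k → Edge → Edge
    shift b (c , a ∷ v) = c ⊕ a , v ∷ʳ b

    lifted-rotate : Edge → Edge
    lifted-rotate x@(c , a ∷ v) = shift a x

    -- The word 0 1 2 ⋯ n, with letters modulo `k`.
    origin : Edge
    origin = zero , Vec.replicate n one

    ChosenEdge-origin : ChosenEdge origin
    ChosenEdge-origin = subst Chosen (sym (Vecₚ.toList-replicate n one)) (Chosen-ones n-1)

    encodeEdge : Edge → Fin (k * k ^ n)
    encodeEdge (c , d) = combine c (encode d)

    encodeEdge-injective : ∀ {x y} → encodeEdge x ≡ encodeEdge y → x ≡ y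
    encodeEdge-injective {c , d} {c′ , d′} eq with Finₚ.combine-injective c (encode d) c′ (encode d′) eq
    ... | c≡c′ , eq′ = cong₂ _,_ c≡c′ (encode-injective d d′ eq′)

    _≟_ : DecidableEquality Edge
    _≟_ = Productₚ.≡-dec Finₚ._≟_ (Vecₚ.≡-dec Finₚ._≟_)

    open Orbit _≟_ encodeEdge encodeEdge-injective public
    open Eulerian front rest ChosenEdge origin public

    lifted-rotate-successor : IsSuccessor lifted-rotate
    lifted-rotate-successor = record { injective = injective ; follows = follows ; closed = λ {x} → closed x }
      where
      injective : ∀ {x y} → lifted-rotate x ≡ lifted-rotate y → x ≡ y
      injective {c , a ∷ v} {c′ , a′ ∷ v′} eq with Productₚ.,-injective eq
      ... | c⊕a≡ , eq′ with Vecₚ.∷ʳ-injective v v′ eq′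
      ...   | refl , refl = cong (_, a ∷ v) (⊕-cancelʳ {a} c⊕a≡)
      follows : ∀ x → front (lifted-rotate x) ≡ rest x
      follows (c , a ∷ v) = cong (c ⊕ a ,_) (Vecₚ.init-∷ʳ a v)
      closed : ∀ x → ChosenEdge x → ChosenEdge (lifted-rotate x)
      closed (c , a ∷ v) ch = subst Chosen (sym (Vecₚ.toList-∷ʳ a v)) (Chosen-rotate (a ∷ toList v) ch)

    shift-one-follows : ∀ x → front (shift one x) ≡ rest x
    shift-one-follows (c , a ∷ v) = cong (c ⊕ a ,_) (Vecₚ.init-∷ʳ one v)

    -- The new differences arise by replacing the first one by 1 and rotating, and both operations
    -- preserve `Chosen`.
    ChosenEdge-shift-one : ∀ x → ChosenEdge x → ChosenEdge (shift one x)
    ChosenEdge-shift-one (c , a ∷ v) ch = subst Chosen (sym (Vecₚ.toList-∷ʳ one v))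
      (Chosen-rotate (one ∷ toList v) (Chosen-one a (toList v) ch))

    ChosenEdge-ones : ∀ c → ChosenEdge (c , Vec.replicate n one)
    ChosenEdge-ones c = ChosenEdge-origin

    replicate-∷ʳ : ∀ {A : Set} m (a : A) → Vec.replicate m a ∷ʳ a ≡ a ∷ Vec.replicate m a
    replicate-∷ʳ zero a = refl
    replicate-∷ʳ (suc m) a = cong (a ∷_) (replicate-∷ʳ m a)

    -- Each step along differences 1 raises the first letter by 1; `j` counts the steps left until
    -- it wraps round to 0, which is `origin`.
    path-ones : ∀ j c → toℕ c + j ≡ k → Path (c , Vec.replicate n one)
    path-ones zero c eq = ⊥-elim (<⇒≢ (Finₚ.toℕ<n c) (trans (sym (+-identityʳ (toℕ c))) eq))
    path-ones (suc zero) c eq = step (ChosenEdge-ones c) (shift-one-follows (c , Vec.replicate n one))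
      (subst Path (cong₂ _,_ (sym wraps) (sym (replicate-∷ʳ n-1 one))) here)
      where
      wraps : c ⊕ one ≡ zero
      wraps = Finₚ.toℕ-injective (trans (toℕ-mod (toℕ c + 1)) (trans (cong (_% k) eq) (n%n≡0 k)))
    path-ones (suc (suc j)) c eq = step (ChosenEdge-ones c) (shift-one-follows (c , Vec.replicate n one))
      (subst Path (cong (c ⊕ one ,_) (sym (replicate-∷ʳ n-1 one))) (path-ones (suc j) (c ⊕ one)
        (trans (cong (_+ suc j) (trans (toℕ-mod (toℕ c + 1)) (m<n⇒m%n≡m no-wrap))) c+1+1+j≡k)))
      where
      c+1+1+j≡k : toℕ c + 1 + suc j ≡ k
      c+1+1+j≡k = trans (+-assoc (toℕ c) 1 (suc j)) eq
      no-wrap : toℕ c + 1 < k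
      no-wrap = subst (toℕ c + 1 <_) c+1+1+j≡k (m<m+n (toℕ c + 1) (s≤s z≤n))

    -- `w` holds the old differences not yet shifted out and `r` counts the ones appended; when `w`
    -- is used up only ones remain.
    path-to-ones : ∀ w r c d → toList d ≡ w ++ ones r → ChosenEdge (c , d) → Path (c , d)
    path-to-ones [] r c d eq ch = subst Path (cong (c ,_) (sym d≡))
      (path-ones (k ∸ toℕ c) c (m+[n∸m]≡n (<⇒≤ (Finₚ.toℕ<n c))))
      where
      r≡n : r ≡ n
      r≡n = trans (sym (Listₚ.length-replicate r)) (trans (cong length (sym eq)) (Vecₚ.length-toList d))
      d≡ : d ≡ Vec.replicate n one
      d≡ = toList-injective (trans eq (trans (cong ones r≡n) (sym (Vecₚ.toList-replicate n one))))
    path-to-ones (b ∷ w) r c (a ∷ v) eq ch = step ch (shift-one-follows (c , a ∷ v))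
      (path-to-ones w (suc r) (c ⊕ a) (v ∷ʳ one) shifted (ChosenEdge-shift-one (c , a ∷ v) ch))
      where
      open ≡-Reasoning
      ones-snoc : ∀ r → ones r ++ one ∷ [] ≡ ones (suc r)
      ones-snoc zero = refl
      ones-snoc (suc r) = cong (one ∷_) (ones-snoc r)
      shifted : toList (v ∷ʳ one) ≡ w ++ ones (suc r)
      shifted = begin
        toList (v ∷ʳ one)              ≡⟨ Vecₚ.toList-∷ʳ one v ⟩
        toList v ++ one ∷ []           ≡⟨ cong (_++ one ∷ []) (Listₚ.∷-injectiveʳ eq) ⟩
        (w ++ ones r) ++ one ∷ []      ≡⟨ Listₚ.++-assoc w (ones r) _ ⟩
        w ++ ones r ++ one ∷ []        ≡⟨ cong (w ++_) (ones-snoc r) ⟩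
        w ++ ones (suc r)              ∎

    path : ∀ x → ChosenEdge x → Path x
    path (c , d) = path-to-ones (toList d) 0 c d (sym (Listₚ.++-identityʳ (toList d)))

    -- Words recovered from their differences.

    integrate : ∀ {m} → Fin k → Vec (Fin k) m → Vec (Fin k) (suc m)
    integrate c [] = c ∷ []
    integrate c (a ∷ v) = c ∷ integrate (c ⊕ a) v

    endpoint : ∀ {m} → Fin k → Vec (Fin k) m → Fin k
    endpoint c [] = c
    endpoint c (a ∷ v) = endpoint (c ⊕ a) v

    nrᵛ : ∀ {m} → Vec (Fin k) m → Vec (Fin k) m
    nrᵛ d = Vec.reverse (Vec.map ⊖_ d)

    nrᵛ-∷ : ∀ {m} a (v : Vec (Fin k) m) → nrᵛ (a ∷ v) ≡ nrᵛ v ∷ʳ (⊖ a)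
    nrᵛ-∷ a v = Vecₚ.reverse-∷ (⊖ a) (Vec.map ⊖_ v)

    toList-nrᵛ : ∀ {m} (d : Vec (Fin k) m) → toList (nrᵛ d) ≡ nr (toList d)
    toList-nrᵛ d = trans (Vecₚ.toList-reverse (Vec.map ⊖_ d)) (cong List.reverse (Vecₚ.toList-map ⊖_ d))

    integrate-injective : ∀ {m} c c′ (d d′ : Vec (Fin k) m) → integrate c d ≡ integrate c′ d′ → (c , d) ≡ (c′ , d′)
    integrate-injective c c′ [] [] eq = cong (_, []) (Vecₚ.∷-injectiveˡ eq)
    integrate-injective c c′ (a ∷ v) (a′ ∷ v′) eq with Vecₚ.∷-injective eq
    ... | refl , eq′ with Productₚ.,-injective (integrate-injective (c ⊕ a) (c ⊕ a′) v v′ eq′)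
    ...   | c⊕a≡ , refl = cong (λ b → c , b ∷ v) (⊕-cancelˡ {c} c⊕a≡)

    integrate-∷ʳ : ∀ {m} c (d : Vec (Fin k) m) b → integrate c (d ∷ʳ b) ≡ integrate c d ∷ʳ (endpoint c d ⊕ b)
    integrate-∷ʳ c [] b = refl
    integrate-∷ʳ c (a ∷ v) b = cong (c ∷_) (integrate-∷ʳ (c ⊕ a) v b)

    endpoint-∷ʳ : ∀ {m} c (d : Vec (Fin k) m) b → endpoint c (d ∷ʳ b) ≡ endpoint c d ⊕ b
    endpoint-∷ʳ c [] b = refl
    endpoint-∷ʳ c (a ∷ v) b = endpoint-∷ʳ (c ⊕ a) v b

    endpoint-nrᵛ : ∀ {m} c (d : Vec (Fin k) m) → endpoint (endpoint c d) (nrᵛ d) ≡ c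
    endpoint-nrᵛ c [] = refl
    endpoint-nrᵛ c (a ∷ v) = begin
      endpoint z (nrᵛ (a ∷ v))           ≡⟨ cong (endpoint z) (nrᵛ-∷ a v) ⟩
      endpoint z (nrᵛ v ∷ʳ (⊖ a))        ≡⟨ endpoint-∷ʳ z (nrᵛ v) (⊖ a) ⟩
      endpoint z (nrᵛ v) ⊕ (⊖ a)         ≡⟨ cong (_⊕ (⊖ a)) (endpoint-nrᵛ (c ⊕ a) v) ⟩
      (c ⊕ a) ⊕ (⊖ a)                    ≡⟨ ⊕-⊖-cancel c a ⟩
      c                                  ∎
      where
      open ≡-Reasoning
      z = endpoint (c ⊕ a) v

    -- Reading backwards starts at the last letter and passes through the negated differences in
    -- reverse order. This is how orientability becomes a condition on differences.
    reverse-integrate : ∀ {m} c (d : Vec (Fin k) m) → Vec.reverse (integrate c d) ≡ integrate (endpoint c d) (nrᵛ d)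
    reverse-integrate c [] = refl
    reverse-integrate c (a ∷ v) = begin
      Vec.reverse (c ∷ integrate (c ⊕ a) v)                             ≡⟨ Vecₚ.reverse-∷ c (integrate (c ⊕ a) v) ⟩
      Vec.reverse (integrate (c ⊕ a) v) ∷ʳ c                            ≡⟨ cong₂ _∷ʳ_ (reverse-integrate (c ⊕ a) v) (sym (⊕-⊖-cancel c a)) ⟩
      integrate z (nrᵛ v) ∷ʳ ((c ⊕ a) ⊕ (⊖ a))                          ≡⟨ cong (λ b → integrate z (nrᵛ v) ∷ʳ (b ⊕ (⊖ a))) (endpoint-nrᵛ (c ⊕ a) v) ⟨
      integrate z (nrᵛ v) ∷ʳ (endpoint z (nrᵛ v) ⊕ (⊖ a))               ≡⟨ integrate-∷ʳ z (nrᵛ v) (⊖ a) ⟨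
      integrate z (nrᵛ v ∷ʳ (⊖ a))                                      ≡⟨ cong (integrate z) (nrᵛ-∷ a v) ⟨
      integrate z (nrᵛ (a ∷ v))                                         ∎
      where
      open ≡-Reasoning
      z = endpoint (c ⊕ a) v

    chosenVecs : List (Vec (Fin k) n)
    chosenVecs = List.filter (Chosen? ∘ toList) (allVecs k n)

    liftedEdges : List Edge
    liftedEdges = List.cartesianProduct (List.allFin k) chosenVecs

    liftedEdges-unique : Unique liftedEdges
    liftedEdges-unique = Uniqueₚ.cartesianProduct⁺ (Uniqueₚ.allFin⁺ k) (Uniqueₚ.filter⁺ (Chosen? ∘ toList) (allVecs-unique k n))

    liftedEdges-chosen : ∀ {x} → x ∈ liftedEdges → ChosenEdge x
    liftedEdges-chosen x∈ = proj₂ (∈-filter⁻ (Chosen? ∘ toList) {xs = allVecs k n}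
      (proj₂ (∈-cartesianProduct⁻ (List.allFin k) chosenVecs x∈)))

    length-liftedEdges : length liftedEdges ≡ k * length chosenVecs
    length-liftedEdges = trans (length-cartesianProductWith _,_ (List.allFin k) chosenVecs)
      (cong (_* length chosenVecs) (length-allFin k))

    -- The sequence read off the cycle of `origin`.

    module _ {f : Edge → Edge} (S : IsSuccessor f) {d : ℕ} (return : fold origin f (suc d) ≡ origin)
             (minimal : ∀ q → q < d → ¬ fold origin f (suc q) ≡ origin) where

      open IsSuccessor S

      private
        p = suc d

        edge : ℕ → Edge
        edge = fold origin f

      s : ℕ → Fin k
      s i = proj₁ (edge i)

      -- Cancelling the first `i` steps of a coincidence would give a return to `origin` before the
      -- minimal one.
      edge-injective : ∀ {i j} → i < j → j < p → edge i ≢ edge j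
      edge-injective {i} {j} i<j j<p eq = minimal q q<d
        (sym (fold-injective f injective i (trans eq (trans (cong edge (sym i+1+q≡j)) (fold-+ origin f i)))))
        where
        q = j ∸ suc i
        i+1+q≡j : i + suc q ≡ j
        i+1+q≡j = trans (+-suc i q) (m+[n∸m]≡n i<j)
        q<d : q < d
        q<d = ≤-trans (subst (suc q ≤_) i+1+q≡j (m≤n+m (suc q) i)) (≤-pred j<p)

      -- Consecutive edges overlap, so removing the first difference of edge `i` leaves a prefix of
      -- the differences of edge `suc i`; the recursion is on the prefix.
      window-integrate : ∀ {m} (w : Vec (Fin k) m) i → w ⊑ proj₂ (edge i) → window s (suc m) i ≡ integrate (s i) w
      window-integrate [] i _ = cong (λ j → s j ∷ []) (+-identityʳ i)
      window-integrate {suc m} (a ∷ w) i prefix = cong₂ _∷_ (cong s (+-identityʳ i)) (begin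
          Vec.tabulate (λ j → s (i + suc (toℕ j)))   ≡⟨ Vecₚ.tabulate-cong (λ j → cong s (+-suc i (toℕ j))) ⟩
          window s (suc m) (suc i)                   ≡⟨ window-integrate w (suc i) (⊑-init (proj₂ (edge (suc i))) (proj₂ next)) ⟩
          integrate (s (suc i)) w                    ≡⟨ cong (λ c → integrate c w) (proj₁ next) ⟩
          integrate (s i ⊕ a) w                      ∎)
        where
        open ≡-Reasoning
        next′ : ∀ x y → front y ≡ rest x → (a ∷ w) ⊑ proj₂ x → proj₁ y ≡ proj₁ x ⊕ a × w ⊑ Vec.init (proj₂ y)
        next′ (c , _ ∷ v) (c′ , d′) eq (_ ∷ w⊑v) with Productₚ.,-injective eq
        ... | c′≡ , refl = c′≡ , w⊑v
        next : s (suc i) ≡ s i ⊕ a × w ⊑ Vec.init (proj₂ (edge (suc i)))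
        next = next′ (edge i) (edge (suc i)) (follows (edge i)) prefix

      window-edge : ∀ i → window s (suc n) i ≡ integrate (s i) (proj₂ (edge i))
      window-edge i = window-integrate (proj₂ (edge i)) i (⊑-refl _)

      isWindowSeq : IsWindowSeq s p (suc n)
      isWindowSeq i j eq with <-cmp (i % p) (j % p)
      ... | tri≈ _ i≡j _ = i≡j
      ... | tri< i<j _ _ = ⊥-elim (edge-injective i<j (m%n<n j p) same)
        where
        same : edge (i % p) ≡ edge (j % p)
        same = trans (sym (fold-% f return i)) (trans (integrate-injective _ _ _ _
                 (trans (sym (window-edge i)) (trans eq (window-edge j)))) (fold-% f return j))
      ... | tri> _ _ j<i = ⊥-elim (edge-injective j<i (m%n<n i p) (sym same))
        where
        same : edge (i % p) ≡ edge (j % p)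
        same = trans (sym (fold-% f return i)) (trans (integrate-injective _ _ _ _
                 (trans (sym (window-edge i)) (trans eq (window-edge j)))) (fold-% f return j))

      hasPeriod : HasPeriod s p
      hasPeriod = s≤s z≤n , (λ i → cong proj₁ (trans (fold-+ origin f i) (cong (λ x → fold x f i) return))) , shortest
        where
        shortest : ∀ q → 0 < q → q < p → ¬ IsPeriodOf s q
        -- A shorter period `q` would make the windows at 0 and `q` equal, against the window
        -- property.
        shortest q 0<q q<p periodic = <⇒≢ 0<q (trans (isWindowSeq 0 q (Vecₚ.tabulate-cong λ j →
          sym (trans (cong s (+-comm q (toℕ j))) (periodic (toℕ j))))) (m<n⇒m%n≡m q<p))

      -- A window equal to a reversed window would have as differences the negated reversal of a
      -- chosen word, while its own differences are chosen.
      isOrientable : IsOrientable s p (suc n)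
      isOrientable = isWindowSeq , λ i j eq →
        ¬Chosen-both (toList (proj₂ (edge j))) (chosen j)
          (subst Chosen (trans (cong toList (proj₂ (Productₚ.,-injective (differences i j eq)))) (toList-nrᵛ (proj₂ (edge j)))) (chosen i))
        where
        chosen : ∀ i → Chosen (toList (proj₂ (edge i)))
        chosen i = Reach-closed ChosenEdge-origin S (i , refl)
        differences : ∀ i j → window s (suc n) i ≡ Vec.reverse (window s (suc n) j) →
                      (s i , proj₂ (edge i)) ≡ (endpoint (s j) (proj₂ (edge j)) , nrᵛ (proj₂ (edge j)))
        differences i j eq = integrate-injective _ _ _ _
          (trans (sym (window-edge i)) (trans eq (trans (cong Vec.reverse (window-edge j)) (reverse-integrate (s j) (proj₂ (edge j))))))

      -- Assigning to each chosen edge a time modulo `p` at which the cycle visits it is injective.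
      period-bound : All (Reach f origin) liftedEdges → k * length chosenVecs ≤ p
      period-bound reached = subst (_≤ p) length-liftedEdges
        (Finₚ.injective⇒≤ {f = λ i → fromℕ< (m%n<n (time i) p)} λ {i} {j} eq →
          lookup-injective liftedEdges-unique i j (trans (sym (at i)) (trans (cong edge (Finₚ.fromℕ<-injective _ _ _ _ eq)) (at j))))
        where
        time : Fin (length liftedEdges) → ℕ
        time i = proj₁ (All.lookup reached (∈-lookup {xs = liftedEdges} i))
        at : ∀ i → edge (time i % p) ≡ List.lookup liftedEdges i
        at i = trans (sym (fold-% f return (time i))) (proj₂ (All.lookup reached (∈-lookup {xs = liftedEdges} i)))

    orientable-sequence : Σ (ℕ → Fin k) λ s → Σ ℕ λ p → Σ (HasPeriod s p) λ hp →
      IsOrientable s p (suc n) {{>-nonZero (proj₁ hp)}} × k * length chosenVecs ≤ p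
    orientable-sequence with cover ChosenEdge-origin lifted-rotate-successor {liftedEdges} (All.tabulate λ {x} x∈ → path x (liftedEdges-chosen x∈))
    ... | f , S , reached with minimal-return f (IsSuccessor.injective S) origin
    ...   | d , return , minimal = s S return minimal , suc d , hasPeriod S return minimal ,
            isOrientable S return minimal , period-bound S return minimal reached

  -- Powers of words and sums of lengths.

  repeat : ∀ {A : Set} → ℕ → List A → List A
  repeat zero u = []
  repeat (suc r) u = u ++ repeat r u

  module _ {A : Set} where

    length-repeat : ∀ r (u : List A) → length (repeat r u) ≡ r * length u
    length-repeat zero u = refl
    length-repeat (suc r) u = trans (Listₚ.length-++ u) (cong (length u +_) (length-repeat r u))

    repeat-+ : ∀ r s (u : List A) → repeat (r + s) u ≡ repeat r u ++ repeat s u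
    repeat-+ zero s u = refl
    repeat-+ (suc r) s u = trans (cong (u ++_) (repeat-+ r s u)) (sym (Listₚ.++-assoc u (repeat r u) (repeat s u)))

    repeat-conjugate : ∀ r (p q : List A) → p ++ repeat r (q ++ p) ≡ repeat r (p ++ q) ++ p
    repeat-conjugate zero p q = Listₚ.++-identityʳ p
    repeat-conjugate (suc r) p q = begin
      p ++ (q ++ p) ++ repeat r (q ++ p)      ≡⟨ cong (p ++_) (Listₚ.++-assoc q p _) ⟩
      p ++ q ++ p ++ repeat r (q ++ p)        ≡⟨ Listₚ.++-assoc p q _ ⟨
      (p ++ q) ++ p ++ repeat r (q ++ p)      ≡⟨ cong ((p ++ q) ++_) (repeat-conjugate r p q) ⟩
      (p ++ q) ++ repeat r (p ++ q) ++ p      ≡⟨ Listₚ.++-assoc (p ++ q) _ p ⟨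
      ((p ++ q) ++ repeat r (p ++ q)) ++ p    ∎
      where open ≡-Reasoning

    repeat-snoc : ∀ r (u : List A) → repeat (suc r) u ≡ repeat r u ++ u
    repeat-snoc zero u = Listₚ.++-identityʳ u
    repeat-snoc (suc r) u = trans (cong (u ++_) (repeat-snoc r u)) (sym (Listₚ.++-assoc u (repeat r u) u))

    repeat-injective : ∀ r {u v : List A} → repeat (suc r) u ≡ repeat (suc r) v → u ≡ v
    repeat-injective r {u} {v} eq = proj₁ (++-injective u v (*-cancelˡ-≡ (length u) (length v) (suc r)
      (trans (sym (length-repeat (suc r) u)) (trans (cong length eq) (length-repeat (suc r) v)))) eq)

    -- The cut after `suc a` letters lies in block `a / suc d`, after `suc (a % suc d)` of its
    -- letters. Counting from one assigns a cut between two blocks to the end of the earlier block,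
    -- where `q` is empty.
    repeat-cut : ∀ {r d a} → a < r * suc d → ∀ (p q : List A) → length (p ++ q) ≡ suc d → length p ≡ suc (a % suc d) →
      ∃₂ λ s t → repeat r (p ++ q) ≡ (repeat s (p ++ q) ++ p) ++ (q ++ repeat t (p ++ q)) ×
                 length (repeat s (p ++ q) ++ p) ≡ suc a
    repeat-cut {r} {d} {a} a<n p q |u| |p| = s , t , (begin
        repeat r u                              ≡⟨ cong (λ r → repeat r u) (trans (+-suc s t) (m+[n∸m]≡n s<r)) ⟨
        repeat (s + suc t) u                    ≡⟨ repeat-+ s (suc t) u ⟩
        repeat s u ++ u ++ repeat t u           ≡⟨ cong (repeat s u ++_) (Listₚ.++-assoc p q _) ⟩
        repeat s u ++ p ++ q ++ repeat t u      ≡⟨ Listₚ.++-assoc (repeat s u) p _ ⟨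
        (repeat s u ++ p) ++ q ++ repeat t u    ∎) , (begin
        length (repeat s u ++ p)                ≡⟨ Listₚ.length-++ (repeat s u) ⟩
        length (repeat s u) + length p          ≡⟨ cong₂ _+_ (length-repeat s u) |p| ⟩
        s * length u + suc (a % suc d)          ≡⟨ cong (λ l → s * l + suc (a % suc d)) |u| ⟩
        s * suc d + suc (a % suc d)             ≡⟨ +-suc (s * suc d) _ ⟩
        suc (s * suc d + a % suc d)             ≡⟨ cong suc (+-comm (s * suc d) _) ⟩
        suc (a % suc d + s * suc d)             ≡⟨ cong suc (m≡m%n+[m/n]*n a (suc d)) ⟨
        suc a                                   ∎)
      where
      open ≡-Reasoning
      u = p ++ q
      s = a / suc d
      s<r : s < r
      s<r = m<n*o⇒m/o<n a<n
      t = r ∸ suc s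

    take-length : ∀ (u v : List A) → List.take (length u) (u ++ v) ≡ u
    take-length [] v = refl
    take-length (a ∷ u) v = cong (a ∷_) (take-length u v)

    length-filter-complement : ∀ {P : A → Set} (P? : Decidable P) xs →
      length (List.filter P? xs) + length (List.filter (¬? ∘ P?) xs) ≡ length xs
    length-filter-complement P? [] = refl
    length-filter-complement P? (x ∷ xs) with P? x
    ... | yes _ = cong suc (length-filter-complement P? xs)
    ... | no _ = trans (+-suc _ _) (cong suc (length-filter-complement P? xs))

  sumBelow : (ℕ → ℕ) → ℕ → ℕ
  sumBelow g zero = 0
  sumBelow g (suc n) = g n + sumBelow g n

  length-concatMap-≤ : ∀ {A : Set} (F : ℕ → List A) (g : ℕ → ℕ) n → (∀ {a} → a < n → length (F a) ≤ g a) →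
    length (List.concatMap F (List.downFrom n)) ≤ sumBelow g n
  length-concatMap-≤ F g zero bound = z≤n
  length-concatMap-≤ F g (suc n) bound = subst (_≤ g n + sumBelow g n) (sym (Listₚ.length-++ (F n)))
    (+-mono-≤ (bound (n<1+n n)) (length-concatMap-≤ F g n (λ a<n → bound (m<n⇒m<1+n a<n))))

  -- Antipalindromes and the count of symmetric words.

  module SymmetricWords (k-1 : ℕ) where

    private k = suc k-1
    open Residues k-1

    antiPalindromes : ∀ l → List (Vec (Fin k) l)
    antiPalindromes zero = [] ∷ []
    antiPalindromes (suc zero) = List.map (_∷ []) self-negative
    antiPalindromes (suc (suc l)) = List.cartesianProductWith (λ a w → a ∷ (w ∷ʳ (⊖ a))) (List.allFin k) (antiPalindromes l)

    #antiPalindromes : ℕ → ℕ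
    #antiPalindromes zero = 1
    #antiPalindromes (suc zero) = δ k
    #antiPalindromes (suc (suc l)) = k * #antiPalindromes l

    length-antiPalindromes : ∀ l → length (antiPalindromes l) ≡ #antiPalindromes l
    length-antiPalindromes zero = refl
    length-antiPalindromes (suc zero) = trans (Listₚ.length-map (_∷ []) self-negative) length-self-negative
    length-antiPalindromes (suc (suc l)) = trans (length-cartesianProductWith _ (List.allFin k) (antiPalindromes l))
      (cong₂ _*_ (length-allFin k) (length-antiPalindromes l))

    antiPalindromes-unique : ∀ l → Unique (antiPalindromes l)
    antiPalindromes-unique zero = [] ∷ []
    antiPalindromes-unique (suc zero) = Uniqueₚ.map⁺ Vecₚ.∷-injectiveˡ self-negative-unique
    antiPalindromes-unique (suc (suc l)) = Uniqueₚ.cartesianProductWith⁺ _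
      (λ {a} {b} {w} {v} eq → Vecₚ.∷-injectiveˡ eq , Vecₚ.∷ʳ-injectiveˡ w v (Vecₚ.∷-injectiveʳ eq))
      (Uniqueₚ.allFin⁺ k) (antiPalindromes-unique l)

    nr-ends : ∀ a w b → nr (a ∷ w ++ b ∷ []) ≡ (⊖ b) ∷ nr w ++ (⊖ a) ∷ []
    nr-ends a w b = trans (nr-++ (a ∷ w) (b ∷ [])) (cong ((⊖ b) ∷_) (nr-++ (a ∷ []) w))

    antiPalindromes-sound : ∀ l {v} → v ∈ antiPalindromes l → AntiPalindrome (toList v)
    antiPalindromes-sound zero {[]} _ = refl
    antiPalindromes-sound (suc zero) v∈ with ∈-map⁻ (_∷ []) v∈
    ... | c , c∈ , refl = cong (_∷ []) (self-negative-sound c∈)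
    antiPalindromes-sound (suc (suc l)) v∈ with ∈-cartesianProductWith⁻ _ (List.allFin k) (antiPalindromes l) v∈
    ... | a , w , _ , w∈ , refl rewrite Vecₚ.toList-∷ʳ (⊖ a) w =
      trans (nr-ends a (toList w) (⊖ a))
        (cong₂ (λ b u → b ∷ u ++ (⊖ a) ∷ []) (⊖-involutive a) (antiPalindromes-sound l w∈))

    antiPalindromes-complete : ∀ l v → AntiPalindrome (toList v) → v ∈ antiPalindromes l
    antiPalindromes-complete zero [] _ = here refl
    antiPalindromes-complete (suc zero) (c ∷ []) eq = ∈-map⁺ (_∷ []) (self-negative-complete c (Listₚ.∷-injectiveˡ eq))
    antiPalindromes-complete (suc (suc l)) (a ∷ v) eq with Vec.initLast v
    ... | w , b , refl rewrite Vecₚ.toList-∷ʳ b w with Listₚ.∷-injective (trans (sym (nr-ends a (toList w) b)) eq)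
    ...   | ⊖b≡a , eq′ = subst (λ c → a ∷ (w ∷ʳ c) ∈ antiPalindromes (suc (suc l)))
              (trans (cong ⊖_ (sym ⊖b≡a)) (⊖-involutive b))
              (∈-cartesianProductWith⁺ (λ a w → a ∷ (w ∷ʳ (⊖ a))) (∈-allFin a)
                (antiPalindromes-complete l w (proj₁ (++-injective (nr (toList w)) (toList w) (length-nr (toList w)) eq′))))

    -- The words of length `a + b` fixed by the reflection that applies `nr` and then rotates by `b`
    -- places.
    fixedWords : ℕ → ℕ → List (List (Fin k))
    fixedWords a b = List.map toList (List.cartesianProductWith Vec._++_ (antiPalindromes a) (antiPalindromes b))

    length-fixedWords : ∀ a b → length (fixedWords a b) ≡ #antiPalindromes a * #antiPalindromes b
    length-fixedWords a b = trans (Listₚ.length-map toList (List.cartesianProductWith Vec._++_ (antiPalindromes a) (antiPalindromes b)))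
      (trans (length-cartesianProductWith Vec._++_ (antiPalindromes a) (antiPalindromes b))
        (cong₂ _*_ (length-antiPalindromes a) (length-antiPalindromes b)))

    fixedWords-unique : ∀ a b → Unique (fixedWords a b)
    fixedWords-unique a b = Uniqueₚ.map⁺ toList-injective (Uniqueₚ.cartesianProductWith⁺ Vec._++_
      (λ {w} {x} eq → Vecₚ.++-injective w x eq) (antiPalindromes-unique a) (antiPalindromes-unique b))

    fixedWords-sound : ∀ a b {u} → u ∈ fixedWords a b →
      ∃₂ λ p q → u ≡ p ++ q × length p ≡ a × length q ≡ b × AntiPalindrome p × AntiPalindrome q
    fixedWords-sound a b u∈ with ∈-map⁻ toList u∈
    ... | _ , v∈ , refl with ∈-cartesianProductWith⁻ Vec._++_ (antiPalindromes a) (antiPalindromes b) v∈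
    ...   | p , q , p∈ , q∈ , refl = toList p , toList q , Vecₚ.toList-++ p q , Vecₚ.length-toList p , Vecₚ.length-toList q ,
              antiPalindromes-sound a p∈ , antiPalindromes-sound b q∈

    fixedWords-complete : ∀ p q → AntiPalindrome p → AntiPalindrome q → p ++ q ∈ fixedWords (length p) (length q)
    fixedWords-complete p q p-anti q-anti = subst (_∈ fixedWords (length p) (length q))
      (trans (Vecₚ.toList-++ (Vec.fromList p) (Vec.fromList q)) (cong₂ _++_ (Vecₚ.toList∘fromList p) (Vecₚ.toList∘fromList q)))
      (∈-map⁺ toList (∈-cartesianProductWith⁺ Vec._++_ (complete p p-anti) (complete q q-anti)))
      where
      complete : ∀ u → AntiPalindrome u → Vec.fromList u ∈ antiPalindromes (length u)
      complete u u-anti = antiPalindromes-complete (length u) (Vec.fromList u)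
        (subst AntiPalindrome (sym (Vecₚ.toList∘fromList u)) u-anti)

    nr-repeat : ∀ r u → nr (repeat r u) ≡ repeat r (nr u)
    nr-repeat zero u = refl
    nr-repeat (suc r) u = trans (nr-++ u (repeat r u)) (trans (cong (_++ nr u) (nr-repeat r u)) (sym (repeat-snoc r (nr u))))

    nr-product : ∀ {p q} → AntiPalindrome p → AntiPalindrome q → nr (p ++ q) ≡ q ++ p
    nr-product {p} {q} p-anti q-anti = trans (nr-++ p q) (cong₂ _++_ q-anti p-anti)

    -- Negated reversal turns `p ++ q` into `q ++ p`, and moving `p` through the blocks turns them
    -- back.
    repeat-antiPalindromeˡ : ∀ s p q → AntiPalindrome p → AntiPalindrome q → AntiPalindrome (repeat s (p ++ q) ++ p)
    repeat-antiPalindromeˡ s p q p-anti q-anti = begin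
      nr (repeat s (p ++ q) ++ p)           ≡⟨ nr-++ (repeat s (p ++ q)) p ⟩
      nr p ++ nr (repeat s (p ++ q))        ≡⟨ cong₂ _++_ p-anti (nr-repeat s (p ++ q)) ⟩
      p ++ repeat s (nr (p ++ q))           ≡⟨ cong (λ u → p ++ repeat s u) (nr-product p-anti q-anti) ⟩
      p ++ repeat s (q ++ p)                ≡⟨ repeat-conjugate s p q ⟩
      repeat s (p ++ q) ++ p                ∎
      where open ≡-Reasoning

    repeat-antiPalindromeʳ : ∀ t p q → AntiPalindrome p → AntiPalindrome q → AntiPalindrome (q ++ repeat t (p ++ q))
    repeat-antiPalindromeʳ t p q p-anti q-anti =
      subst AntiPalindrome (sym (repeat-conjugate t q p)) (repeat-antiPalindromeˡ t q p q-anti p-anti)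

    -- Negated reversal maps the suffix `x` of `w` to a prefix of `w` of the same length, which is
    -- `x` again.
    antiPalindrome-border : ∀ {w} x y z → AntiPalindrome w → w ≡ x ++ y → w ≡ z ++ x → AntiPalindrome x
    antiPalindrome-border x y z w-anti refl w≡z++x =
      proj₁ (++-injective (nr x) x (length-nr x) (trans (sym (nr-++ z x)) (trans (cong nr (sym w≡z++x)) w-anti)))

    -- An upper bound `b` on the number of symmetric words of length `n`; the list may repeat words
    -- and contain others.
    CoveredBy : ℕ → ℕ → Set
    CoveredBy n b = ∃ λ ws → length ws ≤ b × (∀ u → length u ≡ n → Symmetric u → u ∈ ws)

    -- A splitting with empty first part is traded for the one with empty second part, so each
    -- reflection of a word of length `n` is listed once, with the length of `p` from 1 to `n`.
    symmetric-nonempty : ∀ {u} → 0 < length u → Symmetric u →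
      ∃₂ λ p q → u ≡ p ++ q × AntiPalindrome p × AntiPalindrome q × 0 < length p
    symmetric-nonempty _ (a ∷ p , q , refl , p-anti , q-anti) = a ∷ p , q , refl , p-anti , q-anti , s≤s z≤n
    symmetric-nonempty 0<|u| ([] , q , refl , p-anti , q-anti) = q , [] , sym (Listₚ.++-identityʳ q) , q-anti , p-anti , 0<|u|

    -- A symmetric word of length r d is an r-th power of a symmetric word of length d, or it is
    -- fixed by one of the r d reflections without being such a power.
    module Powers (r-1 d-1 : ℕ) where

      private
        r = suc r-1
        d = suc d-1
        n = r * d

      Power : List (Fin k) → Set
      Power u = u ≡ repeat r (List.take d u)

      Power? : Decidable Power
      Power? u = Listₚ.≡-dec Finₚ._≟_ u (repeat r (List.take d u))

      power : ∀ v → length v ≡ d → Power (repeat r v)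
      power v |v| = cong (repeat r) (sym (trans (cong (λ l → List.take l (repeat r v)) (sym |v|)) (take-length v _)))

      -- Cut one block where the end of `p` falls inside it. Then `p′` both begins and ends `p`, and
      -- `q′` both begins and ends `q`, so they are borders of antipalindromes.
      base-symmetric : ∀ v p q → length v ≡ d → repeat r v ≡ p ++ q → AntiPalindrome p → AntiPalindrome q →
                       0 < length p → Symmetric v
      base-symmetric v (c ∷ p₀) q |v| eq p-anti q-anti _ = p′ , q′ , sym v≡ , p′-anti s p-eq , q′-anti t q-eq
        where
        p = c ∷ p₀
        a = length p₀
        p′ = List.take (suc (a % d)) v
        q′ = List.drop (suc (a % d)) v
        v≡ : p′ ++ q′ ≡ v
        v≡ = Listₚ.take++drop≡id (suc (a % d)) v
        |p′| : length p′ ≡ suc (a % d)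
        |p′| = trans (Listₚ.length-take (suc (a % d)) v) (m≤n⇒m⊓n≡m (subst (suc (a % d) ≤_) (sym |v|) (m%n<n a d)))
        a<n : a < n
        a<n = subst (a <_) (trans (sym (Listₚ.length-++ p)) (trans (cong length (sym eq)) (trans (length-repeat r v) (cong (r *_) |v|))))
                (m≤m+n (length p) (length q))
        cut = repeat-cut {r = r} {d = d-1} a<n p′ q′ (trans (cong length v≡) |v|) |p′|
        s = proj₁ cut
        t = proj₁ (proj₂ cut)
        u′ = p′ ++ q′
        parts : repeat s u′ ++ p′ ≡ p × q′ ++ repeat t u′ ≡ q
        parts = ++-injective (repeat s u′ ++ p′) p (proj₂ (proj₂ (proj₂ cut)))
                  (trans (sym (proj₁ (proj₂ (proj₂ cut)))) (trans (cong (repeat r) v≡) eq))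
        p-eq = proj₁ parts
        q-eq = proj₂ parts
        p′-anti : ∀ s → repeat s u′ ++ p′ ≡ p → AntiPalindrome p′
        p′-anti zero eq = subst AntiPalindrome (sym eq) p-anti
        p′-anti (suc s) eq = antiPalindrome-border p′ _ (repeat (suc s) u′) p-anti
          (trans (sym eq) (trans (cong (_++ p′) (Listₚ.++-assoc p′ q′ (repeat s u′))) (Listₚ.++-assoc p′ (q′ ++ repeat s u′) p′)))
          (sym eq)
        q′-anti : ∀ t → q′ ++ repeat t u′ ≡ q → AntiPalindrome q′
        q′-anti zero eq = subst AntiPalindrome (sym (trans (sym (Listₚ.++-identityʳ q′)) eq)) q-anti
        q′-anti (suc t) eq = antiPalindrome-border q′ (repeat (suc t) u′) _ q-anti (sym eq)
          (trans (sym eq) (trans (cong (q′ ++_) (repeat-snoc t u′)) (trans (cong (q′ ++_) (sym (Listₚ.++-assoc (repeat t u′) p′ q′)))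
            (sym (Listₚ.++-assoc q′ (repeat t u′ ++ p′) q′)))))

      -- If a block splits into antipalindromes at the place where the cut after `suc a` letters
      -- falls, then its `r`-th power splits into antipalindromes at `suc a`. Distinct blocks have
      -- distinct powers.
      #powers : ∀ {a} → a < n →
        #antiPalindromes (suc (a % d)) * #antiPalindromes (d ∸ suc (a % d))
          ≤ length (List.filter Power? (fixedWords (suc a) (n ∸ suc a)))
      #powers {a} a<n = subst (_≤ length (List.filter Power? (fixedWords (suc a) (n ∸ suc a))))
        (trans (Listₚ.length-map (repeat r) (fixedWords a′ b′)) (length-fixedWords a′ b′))
        (length-≤-⊆ (Uniqueₚ.map⁺ (repeat-injective r-1) (fixedWords-unique a′ b′)) λ w∈ → powers (∈-map⁻ (repeat r) w∈))
        where
        a′ = suc (a % d)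
        b′ = d ∸ a′
        powers : ∀ {w} → (∃ λ v → v ∈ fixedWords a′ b′ × w ≡ repeat r v) → w ∈ List.filter Power? (fixedWords (suc a) (n ∸ suc a))
        powers (v , v∈ , refl) with fixedWords-sound a′ b′ v∈
        ... | p , q , refl , |p| , |q| , p-anti , q-anti = ∈-filter⁺ Power? {xs = fixedWords (suc a) (n ∸ suc a)} w∈ (power (p ++ q) |v|)
          where
          |v| : length (p ++ q) ≡ d
          |v| = trans (Listₚ.length-++ p) (trans (cong₂ _+_ |p| |q|) (m+[n∸m]≡n (m%n<n a d)))
          cut = repeat-cut {r = r} {d = d-1} a<n p q |v| |p|
          s = proj₁ cut
          t = proj₁ (proj₂ cut)
          P = repeat s (p ++ q) ++ p
          Q = q ++ repeat t (p ++ q)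
          eq : repeat r (p ++ q) ≡ P ++ Q
          eq = proj₁ (proj₂ (proj₂ cut))
          |P| : length P ≡ suc a
          |P| = proj₂ (proj₂ (proj₂ cut))
          |Q| : length Q ≡ n ∸ suc a
          |Q| = begin
            length Q                              ≡⟨ m+n∸m≡n (length P) (length Q) ⟨
            length P + length Q ∸ length P        ≡⟨ cong (_∸ length P) (Listₚ.length-++ P) ⟨
            length (P ++ Q) ∸ length P            ≡⟨ cong (λ w → length w ∸ length P) eq ⟨
            length (repeat r (p ++ q)) ∸ length P ≡⟨ cong₂ _∸_ (trans (length-repeat r (p ++ q)) (cong (r *_) |v|)) |P| ⟩
            n ∸ suc a                             ∎
            where open ≡-Reasoning
          w∈ : repeat r (p ++ q) ∈ fixedWords (suc a) (n ∸ suc a)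
          w∈ = subst₂ _∈_ (sym eq) (cong₂ fixedWords |P| |Q|)
            (fixedWords-complete P Q (repeat-antiPalindromeˡ s p q p-anti q-anti) (repeat-antiPalindromeʳ t p q p-anti q-anti))

      nonPowers : ℕ → List (List (Fin k))
      nonPowers a = List.filter (¬? ∘ Power?) (fixedWords (suc a) (n ∸ suc a))

      -- Powers are listed once, through their blocks, at cost `b`. A reflection fixes at most
      -- `c + g a` words, of which at least `c` are powers, so it adds at most `g a` further words.
      cover-powers : ∀ {b} c (g : ℕ → ℕ) → CoveredBy d b →
        (∀ {a} → a < d → c ≤ #antiPalindromes (suc a) * #antiPalindromes (d ∸ suc a)) →
        (∀ {a} → a < n → #antiPalindromes (suc a) * #antiPalindromes (n ∸ suc a) ≤ c + g a) →
        CoveredBy n (b + sumBelow g n)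
      cover-powers {b} c g (ws , |ws| , ws-cover) c≤ ≤c+g =
        List.map (repeat r) ws ++ List.concatMap nonPowers (List.downFrom n) ,
        subst (_≤ b + sumBelow g n) (sym (Listₚ.length-++ (List.map (repeat r) ws)))
          (+-mono-≤ (subst (_≤ b) (sym (Listₚ.length-map (repeat r) ws)) |ws|) (length-concatMap-≤ nonPowers g n #nonPowers)) ,
        covered
        where
        #nonPowers : ∀ {a} → a < n → length (nonPowers a) ≤ g a
        #nonPowers {a} a<n = +-cancelˡ-≤ c _ _ (begin
          c + length (nonPowers a)                                                          ≤⟨ +-monoˡ-≤ _ (≤-trans (c≤ (m%n<n a d)) (#powers a<n)) ⟩
          length (List.filter Power? (fixedWords (suc a) (n ∸ suc a))) + length (nonPowers a) ≡⟨ length-filter-complement Power? (fixedWords (suc a) (n ∸ suc a)) ⟩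
          length (fixedWords (suc a) (n ∸ suc a))                                           ≡⟨ length-fixedWords (suc a) (n ∸ suc a) ⟩
          #antiPalindromes (suc a) * #antiPalindromes (n ∸ suc a)                           ≤⟨ ≤c+g a<n ⟩
          c + g a                                                                           ∎)
          where open ≤-Reasoning
        covered : ∀ u → length u ≡ n → Symmetric u → u ∈ List.map (repeat r) ws ++ List.concatMap nonPowers (List.downFrom n)
        covered u |u| u-sym with symmetric-nonempty (subst (0 <_) (sym |u|) (s≤s z≤n)) u-sym
        ... | p , q , u≡ , p-anti , q-anti , 0<|p| with Power? u
        ...   | yes u-power = ∈-++⁺ˡ (subst (_∈ List.map (repeat r) ws) (sym u-power)
                  (∈-map⁺ (repeat r) (ws-cover v |v| (base-symmetric v p q |v| (trans (sym u-power) u≡) p-anti q-anti 0<|p|))))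
          where
          v = List.take d u
          |v| : length v ≡ d
          |v| = trans (Listₚ.length-take d u) (m≤n⇒m⊓n≡m (subst (d ≤_) (sym |u|) (m≤m+n d (r-1 * d))))
        covered u |u| u-sym | c ∷ p , q , refl , p-anti , q-anti , _ | no ¬power =
          ∈-++⁺ʳ (List.map (repeat r) ws) (∈-concat⁺′ (∈-filter⁺ (¬? ∘ Power?) {xs = fixedWords (suc (length p)) (n ∸ suc (length p))} u∈ ¬power)
            (∈-map⁺ nonPowers (∈-downFrom⁺ a<n)))
          where
          |u|′ : suc (length p) + length q ≡ n
          |u|′ = trans (sym (Listₚ.length-++ (c ∷ p))) |u|
          a<n : length p < n
          a<n = subst (length p <_) |u|′ (m≤m+n (suc (length p)) (length q))
          u∈ : (c ∷ p) ++ q ∈ fixedWords (suc (length p)) (n ∸ suc (length p))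
          u∈ = subst (λ b → (c ∷ p) ++ q ∈ fixedWords (suc (length p)) b)
            (trans (sym (m+n∸m≡n (suc (length p)) (length q))) (cong (_∸ suc (length p)) |u|′))
            (fixedWords-complete (c ∷ p) q p-anti q-anti)

  -- Parity, odd parts and the arithmetic of `twiceS`.

  open import Data.Integer as ℤ using (+_)
  import Data.Integer.Properties as ℤₚ
  import Data.Integer.Tactic.RingSolver as ℤSolver

  δ-bounds : ∀ k → 1 ≤ δ k × δ k ≤ 2
  δ-bounds k with k % 2
  ... | zero = s≤s z≤n , s≤s (s≤s z≤n)
  ... | suc _ = s≤s z≤n , s≤s z≤n

  parity : ∀ a → (∃ λ i → a ≡ i * 2) ⊎ (∃ λ i → a ≡ 1 + i * 2)
  parity zero = inj₁ (0 , refl)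
  parity (suc a) with parity a
  ... | inj₁ (i , refl) = inj₂ (i , refl)
  ... | inj₂ (i , refl) = inj₁ (suc i , refl)

  alternate : ℕ → ℕ → ℕ → ℕ
  alternate x y zero = x
  alternate x y (suc zero) = y
  alternate x y (suc (suc a)) = alternate x y a

  alternate-even : ∀ x y i → alternate x y (i * 2) ≡ x
  alternate-even x y zero = refl
  alternate-even x y (suc i) = alternate-even x y i

  alternate-odd : ∀ x y i → alternate x y (1 + i * 2) ≡ y
  alternate-odd x y zero = refl
  alternate-odd x y (suc i) = alternate-odd x y i

  sumBelow-alternate : ∀ x y h → sumBelow (alternate x y) (h * 2) ≡ h * (x + y)
  sumBelow-alternate x y zero = refl
  sumBelow-alternate x y (suc h) = begin
    alternate x y (1 + h * 2) + (alternate x y (h * 2) + sumBelow (alternate x y) (h * 2))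
      ≡⟨ cong₂ _+_ (alternate-odd x y h) (cong₂ _+_ (alternate-even x y h) (sumBelow-alternate x y h)) ⟩
    y + (x + h * (x + y))   ≡⟨ +-assoc y x _ ⟨
    y + x + h * (x + y)     ≡⟨ cong (_+ h * (x + y)) (+-comm y x) ⟩
    suc h * (x + y)         ∎
    where open ≡-Reasoning

  sumBelow-const : ∀ x n → sumBelow (λ _ → x) n ≡ n * x
  sumBelow-const x zero = refl
  sumBelow-const x (suc n) = cong (λ z → x + z) (sumBelow-const x n)

  -- Fuel `f ≥ n` suffices because halving a positive number decreases it; of the cofactor `r` only
  -- its existence is recorded.
  oddPartAux-spec : ∀ f n → n ≤ f → 1 ≤ n → ∃ λ r → n ≡ r * oddPartAux f n × oddPartAux f n % 2 ≡ 1
  oddPartAux-spec (suc f) (suc n) (s≤s n≤f) _ with suc n % 2 in eq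
  ... | suc zero = 1 , sym (*-identityˡ (suc n)) , eq
  ... | suc (suc x) = ⊥-elim (<⇒≱ (m%n<n (suc n) 2) (subst (2 ≤_) (sym eq) (s≤s (s≤s z≤n))))
  ... | zero with oddPartAux-spec f (suc n / 2) half≤f 1≤half
    where
    half≤f : suc n / 2 ≤ f
    half≤f = ≤-trans (≤-pred (m/n<m (suc n) 2 (s≤s (s≤s z≤n)))) n≤f
    1≤half : 1 ≤ suc n / 2
    1≤half with suc n / 2 in eq′
    ... | suc _ = s≤s z≤n
    ... | zero with trans (m≡m%n+[m/n]*n (suc n) 2) (cong₂ _+_ eq (cong (_* 2) eq′))
    ...   | ()
  ...   | r , n/2≡ , odd = r * 2 , (begin
      suc n                                  ≡⟨ m≡m%n+[m/n]*n (suc n) 2 ⟩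
      suc n % 2 + suc n / 2 * 2              ≡⟨ cong (_+ suc n / 2 * 2) eq ⟩
      suc n / 2 * 2                          ≡⟨ cong (_* 2) n/2≡ ⟩
      r * m * 2                              ≡⟨ *-assoc r m 2 ⟩
      r * (m * 2)                            ≡⟨ cong (r *_) (*-comm m 2) ⟩
      r * (2 * m)                            ≡⟨ *-assoc r 2 m ⟨
      r * 2 * m                              ∎) , odd
    where
    open ≡-Reasoning
    m = oddPartAux f (suc n / 2)

  oddPart-spec : ∀ n → 1 ≤ n → ∃ λ r → n ≡ r * oddPart n × oddPart n % 2 ≡ 1
  oddPart-spec n = oddPartAux-spec n n ≤-refl

  n%2≡0⊎1 : ∀ n → n % 2 ≡ 0 ⊎ n % 2 ≡ 1
  n%2≡0⊎1 zero = inj₁ refl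
  n%2≡0⊎1 (suc zero) = inj₂ refl
  n%2≡0⊎1 (suc (suc n)) = n%2≡0⊎1 n

  odd-form : ∀ n → n % 2 ≡ 1 → n ≡ 1 + n / 2 * 2
  odd-form n odd = trans (m≡m%n+[m/n]*n n 2) (cong (_+ n / 2 * 2) odd)

  even-form : ∀ n → n % 2 ≡ 0 → n ≡ n / 2 * 2
  even-form n even = trans (m≡m%n+[m/n]*n n 2) (cong (_+ n / 2 * 2) even)

  -- An odd divisor of an even number has cofactor at least 2. The bound makes the truncated
  -- subtractions in `cover-even` exact.
  odd-divisor-≤-half : ∀ r {j h} → suc h * 2 ≡ r * (1 + j * 2) → j ≤ h
  odd-divisor-≤-half (suc zero) {j} {h} eq = ⊥-elim (0≢1+n (begin
    0                        ≡⟨ m*n%n≡0 (suc h) 2 ⟨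
    suc h * 2 % 2            ≡⟨ cong (_% 2) (trans eq (*-identityˡ _)) ⟩
    (1 + j * 2) % 2          ≡⟨ [m+kn]%n≡m%n 1 j 2 ⟩
    1                        ∎))
    where open ≡-Reasoning
  odd-divisor-≤-half (suc (suc r)) {j} {h} eq = ≤-pred (≤-trans (s≤s (m≤m*n j 2)) (*-cancelʳ-≤ (1 + j * 2) (suc h) 2 (begin
    (1 + j * 2) * 2                    ≡⟨ *-comm (1 + j * 2) 2 ⟩
    2 * (1 + j * 2)                    ≤⟨ *-monoˡ-≤ (1 + j * 2) (s≤s (s≤s (z≤n {r}))) ⟩
    suc (suc r) * (1 + j * 2)          ≡⟨ eq ⟨
    suc h * 2                          ∎)))
    where open ≤-Reasoning

  m≤c+d⇒m-d≤c : ∀ {m c d} → m ≤ c + d → + m ℤ.- + d ℤ.≤ + c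
  m≤c+d⇒m-d≤c {m} {c} {d} le = begin
    + m ℤ.- + d               ≤⟨ ℤₚ.+-monoˡ-≤ (ℤ.- + d) (ℤ.+≤+ le) ⟩
    + c ℤ.+ + d ℤ.- + d       ≡⟨ cancel (+ c) (+ d) ⟩
    + c                       ∎
    where
    open ℤₚ.≤-Reasoning
    cancel : ∀ x y → x ℤ.+ y ℤ.- y ≡ x
    cancel = ℤSolver.solve-∀

  pos-pred : ∀ {m} → 1 ≤ m → + m ℤ.- + 1 ≡ + (m ∸ 1)
  pos-pred {m} 1≤m = trans (ℤₚ.m-n≡m⊖n m 1) (ℤₚ.⊖-≥ 1≤m)

  twiceS-odd : ∀ k n → n % 2 ≡ 1 →
    twiceS k n ≡ + (k ^ n) ℤ.- + δ k ℤ.* (+ n ℤ.* (+ (k ^ (n / 2)) ℤ.- + 1) ℤ.+ + 1)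
  twiceS-odd k n odd with n % 2
  ... | suc _ = refl

  twiceS-even : ∀ k n → n % 2 ≡ 0 →
    twiceS k n ≡ + (k ^ n) ℤ.- + ((n / 2) * k ^ ((n / 2) ∸ 1)) ℤ.* + (δ k * δ k + k)
      ℤ.+ + (n * δ k * k ^ (oddPart n / 2)) ℤ.- + (oddPart n * δ k) ℤ.* (+ (k ^ (oddPart n / 2)) ℤ.- + 1) ℤ.- + δ k
  twiceS-even k n even with n % 2
  ... | zero = refl

  -- The subtracted term moves across the inequality, which leaves a count in ℕ; `∸ 1` is exact
  -- because powers of `k` are positive.
  twiceS-odd-≤ : ∀ {k} .{{_ : NonZero k}} n {c} → n % 2 ≡ 1 →
    k ^ n ≤ c + δ k * (n * (k ^ (n / 2) ∸ 1) + 1) → twiceS k n ℤ.≤ + c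
  twiceS-odd-≤ {k} n {c} odd le = begin
    twiceS k n                                              ≡⟨ twiceS-odd k n odd ⟩
    + (k ^ n) ℤ.- + δ k ℤ.* (+ n ℤ.* (+ K ℤ.- + 1) ℤ.+ + 1) ≡⟨ cong (λ z → + (k ^ n) ℤ.- + δ k ℤ.* (+ n ℤ.* z ℤ.+ + 1)) (pos-pred (m^n>0 k (n / 2))) ⟩
    + (k ^ n) ℤ.- + δ k ℤ.* (+ n ℤ.* + (K ∸ 1) ℤ.+ + 1)     ≡⟨ cong (λ z → + (k ^ n) ℤ.- + δ k ℤ.* (z ℤ.+ + 1)) (ℤₚ.pos-* n (K ∸ 1)) ⟨
    + (k ^ n) ℤ.- + δ k ℤ.* + (n * (K ∸ 1) + 1)             ≡⟨ cong (λ z → + (k ^ n) ℤ.- z) (ℤₚ.pos-* (δ k) (n * (K ∸ 1) + 1)) ⟨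
    + (k ^ n) ℤ.- + (δ k * (n * (K ∸ 1) + 1))               ≤⟨ m≤c+d⇒m-d≤c le ⟩
    + c                                                     ∎
    where
    open ℤₚ.≤-Reasoning
    K = k ^ (n / 2)

  signed-sum-≤ : ∀ a p q b t x d {c} → 1 ≤ x → a + b ≤ c + (p * q + t * (x ∸ 1) + d) →
    + a ℤ.- + p ℤ.* + q ℤ.+ + b ℤ.- + t ℤ.* (+ x ℤ.- + 1) ℤ.- + d ℤ.≤ + c
  signed-sum-≤ a p q b t x d {c} 1≤x le = begin
    + a ℤ.- + p ℤ.* + q ℤ.+ + b ℤ.- + t ℤ.* (+ x ℤ.- + 1) ℤ.- + d
      ≡⟨ cong (λ z → + a ℤ.- + p ℤ.* + q ℤ.+ + b ℤ.- + t ℤ.* z ℤ.- + d) (pos-pred 1≤x) ⟩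
    + a ℤ.- + p ℤ.* + q ℤ.+ + b ℤ.- + t ℤ.* + (x ∸ 1) ℤ.- + d
      ≡⟨ cong₂ (λ y z → + a ℤ.- y ℤ.+ + b ℤ.- z ℤ.- + d) (ℤₚ.pos-* p q) (ℤₚ.pos-* t (x ∸ 1)) ⟨
    + a ℤ.- + (p * q) ℤ.+ + b ℤ.- + (t * (x ∸ 1)) ℤ.- + d
      ≡⟨ collect (+ a) (+ (p * q)) (+ b) (+ (t * (x ∸ 1))) (+ d) ⟩
    + (a + b) ℤ.- + (p * q + t * (x ∸ 1) + d)
      ≤⟨ m≤c+d⇒m-d≤c le ⟩
    + c ∎
    where
    open ℤₚ.≤-Reasoning
    collect : ∀ a p b q d → a ℤ.- p ℤ.+ b ℤ.- q ℤ.- d ≡ (a ℤ.+ b) ℤ.- (p ℤ.+ q ℤ.+ d)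
    collect = ℤSolver.solve-∀

  twiceS-even-≤ : ∀ {k} .{{_ : NonZero k}} n {c} → n % 2 ≡ 0 →
    k ^ n + n * δ k * k ^ (oddPart n / 2) ≤
      c + (n / 2 * k ^ (n / 2 ∸ 1) * (δ k * δ k + k) + oddPart n * δ k * (k ^ (oddPart n / 2) ∸ 1) + δ k) →
    twiceS k n ℤ.≤ + c
  twiceS-even-≤ {k} n even le =
    ℤₚ.≤-trans (ℤₚ.≤-reflexive (twiceS-even k n even)) (signed-sum-≤
      (k ^ n) (n / 2 * k ^ (n / 2 ∸ 1)) (δ k * δ k + k) (n * δ k * k ^ (oddPart n / 2)) (oddPart n * δ k)
      (k ^ (oddPart n / 2)) (δ k) (m^n>0 k (oddPart n / 2)) le)

  -- The term `n * d * e` supplies `d * e` twice for each of `suc h` pairs of reflections, which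
  -- restores both truncated differences to `d * d * kʰ` and `k * kʰ`.
  even-regroup : ∀ {n k kⁿ c m h kʰ d e} → n ≡ suc h * 2 → d * e ≤ d * d * kʰ → d * e ≤ k * kʰ →
    kⁿ ≤ c + (d + m * (d * (e ∸ 1)) + suc h * ((d * d * kʰ ∸ d * e) + (k * kʰ ∸ d * e))) →
    kⁿ + n * d * e ≤ c + (suc h * kʰ * (d * d + k) + m * d * (e ∸ 1) + d)
  even-regroup {n} {k} {kⁿ} {c} {m} {h} {kʰ} {d} {e} n≡ de≤ddkʰ de≤kkʰ le = begin
    kⁿ + n * d * e
      ≤⟨ +-monoˡ-≤ (n * d * e) le ⟩
    c + (d + m * (d * (e ∸ 1)) + suc h * (x + y)) + n * d * e
      ≡⟨ cong (λ n → c + (d + m * (d * (e ∸ 1)) + suc h * (x + y)) + n * d * e) n≡ ⟩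
    c + (d + m * (d * (e ∸ 1)) + suc h * (x + y)) + suc h * 2 * d * e
      ≡⟨ distribute c d m (e ∸ 1) (suc h) x y e ⟩
    c + (d + m * (d * (e ∸ 1)) + suc h * ((x + d * e) + (y + d * e)))
      ≡⟨ cong₂ (λ x y → c + (d + m * (d * (e ∸ 1)) + suc h * (x + y))) (m∸n+n≡m de≤ddkʰ) (m∸n+n≡m de≤kkʰ) ⟩
    c + (d + m * (d * (e ∸ 1)) + suc h * (d * d * kʰ + k * kʰ))
      ≡⟨ collect c d m (e ∸ 1) (suc h) k kʰ ⟩
    c + (suc h * kʰ * (d * d + k) + m * d * (e ∸ 1) + d)
      ∎
    where
    open ≤-Reasoning
    x = d * d * kʰ ∸ d * e
    y = k * kʰ ∸ d * e
    distribute : ∀ c d m e₁ h x y e → c + (d + m * (d * e₁) + h * (x + y)) + h * 2 * d * e ≡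
                                       c + (d + m * (d * e₁) + h * ((x + d * e) + (y + d * e)))
    distribute = ℕSolver.solve-∀
    collect : ∀ c d m e₁ h k kʰ → c + (d + m * (d * e₁) + h * (d * d * kʰ + k * kʰ)) ≡
                                   c + (h * kʰ * (d * d + k) + m * d * e₁ + d)
    collect = ℕSolver.solve-∀

  -- The lower bound on the number of chosen words.

  module Bound (k-3 : ℕ) where

    private k = 3 + k-3
    open Orientation k-3
    open SymmetricWords (2 + k-3)

    -- Every word is chosen, the negated reversal of a chosen word, or symmetric.
    k^n-bound : ∀ {n-1 b} → CoveredBy (suc n-1) b → k ^ suc n-1 ≤ 2 * length (Lift.chosenVecs k-3 n-1) + b
    k^n-bound {n-1} {b} (ws , |ws| , ws-cover) = begin
      k ^ n                                                         ≡⟨ length-allVecs k n ⟨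
      length (allVecs k n)                                          ≡⟨ Listₚ.length-map toList (allVecs k n) ⟨
      length (List.map toList (allVecs k n))                        ≤⟨ length-≤-⊆ (Uniqueₚ.map⁺ toList-injective (allVecs-unique k n)) classify ⟩
      length (chosen ++ (opposite ++ ws))                           ≡⟨ Listₚ.length-++ chosen ⟩
      length chosen + length (opposite ++ ws)                       ≡⟨ cong (λ z → length chosen + z) (Listₚ.length-++ opposite) ⟩
      length chosen + (length opposite + length ws)                 ≡⟨ cong₂ (λ x y → x + (y + length ws)) (Listₚ.length-map toList chosenVecs) (Listₚ.length-map (nr ∘ toList) chosenVecs) ⟩
      c + (c + length ws)                                           ≡⟨ +-assoc c c _ ⟨
      c + c + length ws                                             ≤⟨ +-mono-≤ (≤-reflexive (cong (λ z → c + z) (sym (+-identityʳ c)))) |ws| ⟩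
      2 * c + b                                                     ∎
      where
      open ≤-Reasoning
      open Lift k-3 n-1 using (chosenVecs; nrᵛ; toList-nrᵛ)
      n = suc n-1
      c = length chosenVecs
      chosen = List.map toList chosenVecs
      opposite = List.map (nr ∘ toList) chosenVecs
      ∈-chosenVecs : ∀ v → Chosen (toList v) → v ∈ chosenVecs
      ∈-chosenVecs v = ∈-filter⁺ (Chosen? ∘ toList) (∈-allVecs v)
      classify : ∀ {u} → u ∈ List.map toList (allVecs k n) → u ∈ chosen ++ (opposite ++ ws)
      classify u∈ with ∈-map⁻ toList u∈
      ... | v , _ , refl with Chosen-or-Symmetric (toList v)
      ...   | inj₁ ch = ∈-++⁺ˡ (∈-map⁺ toList (∈-chosenVecs v ch))
      ...   | inj₂ (inj₁ ch) = ∈-++⁺ʳ chosen (∈-++⁺ˡ (subst (_∈ opposite)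
                (trans (cong nr (toList-nrᵛ v)) (nr-involutive (toList v)))
                (∈-map⁺ (nr ∘ toList) (∈-chosenVecs (nrᵛ v) (subst Chosen (sym (toList-nrᵛ v)) ch)))))
      ...   | inj₂ (inj₂ sym-v) = ∈-++⁺ʳ chosen (∈-++⁺ʳ opposite (ws-cover (toList v) (Vecₚ.length-toList v) sym-v))

    #-even : ∀ h → #antiPalindromes (h * 2) ≡ k ^ h
    #-even zero = refl
    #-even (suc h) = cong (k *_) (#-even h)

    private
      swap-factors : ∀ x y z → x * (y * z) ≡ y * (x * z)
      swap-factors = ℕSolver.solve-∀

    #-odd : ∀ h → #antiPalindromes (1 + h * 2) ≡ δ k * k ^ h
    #-odd zero = sym (*-identityʳ (δ k))
    #-odd (suc h) = trans (cong (k *_) (#-odd h)) (swap-factors k (δ k) (k ^ h))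

    -- Exactly one of the two lengths is odd, so the central letter contributes one factor `δ k`
    -- whatever the splitting.
    #-product-odd : ∀ x y h → x + y ≡ 1 + h * 2 → #antiPalindromes x * #antiPalindromes y ≡ δ k * k ^ h
    #-product-odd zero y h refl = trans (*-identityˡ (#antiPalindromes (1 + h * 2))) (#-odd h)
    #-product-odd (suc zero) y h refl = cong (δ k *_) (#-even h)
    #-product-odd (suc (suc x)) y (suc h) eq = begin
      k * #antiPalindromes x * #antiPalindromes y     ≡⟨ *-assoc k (#antiPalindromes x) (#antiPalindromes y) ⟩
      k * (#antiPalindromes x * #antiPalindromes y)   ≡⟨ cong (k *_) (#-product-odd x y h (suc-injective (suc-injective eq))) ⟩
      k * (δ k * k ^ h)                               ≡⟨ swap-factors k (δ k) (k ^ h) ⟩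
      δ k * (k * k ^ h)                               ∎
      where open ≡-Reasoning

    #-product-even : ∀ i y h → i * 2 + y ≡ h * 2 → #antiPalindromes (i * 2) * #antiPalindromes y ≡ k ^ h
    #-product-even zero y h refl = trans (*-identityˡ (#antiPalindromes (h * 2))) (#-even h)
    #-product-even (suc i) y (suc h) eq = trans (*-assoc k (#antiPalindromes (i * 2)) (#antiPalindromes y))
      (cong (k *_) (#-product-even i y h (suc-injective (suc-injective eq))))

    #-product-odd-odd : ∀ i y h → 1 + i * 2 + y ≡ suc h * 2 →
      #antiPalindromes (1 + i * 2) * #antiPalindromes y ≡ δ k * δ k * k ^ h
    #-product-odd-odd zero y h refl = trans (cong (δ k *_) (#-odd h)) (sym (*-assoc (δ k) (δ k) (k ^ h)))
    #-product-odd-odd (suc i) y (suc h) eq = begin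
      k * #antiPalindromes (1 + i * 2) * #antiPalindromes y     ≡⟨ *-assoc k (#antiPalindromes (1 + i * 2)) (#antiPalindromes y) ⟩
      k * (#antiPalindromes (1 + i * 2) * #antiPalindromes y)   ≡⟨ cong (k *_) (#-product-odd-odd i y h (suc-injective (suc-injective eq))) ⟩
      k * (δ k * δ k * k ^ h)                                   ≡⟨ swap-factors k (δ k * δ k) (k ^ h) ⟩
      δ k * δ k * (k * k ^ h)                                   ∎
      where open ≡-Reasoning

    cover-one : CoveredBy 1 (δ k)
    cover-one = List.map (_∷ []) self-negative , ≤-reflexive (trans (Listₚ.length-map (_∷ []) self-negative) length-self-negative) , covered
      where
      self : ∀ c → AntiPalindrome (c ∷ []) → (c ∷ []) ∈ List.map (_∷ []) self-negative
      self c eq = ∈-map⁺ (_∷ []) (self-negative-complete c (Listₚ.∷-injectiveˡ eq))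
      covered : ∀ u → length u ≡ 1 → Symmetric u → u ∈ List.map (_∷ []) self-negative
      covered (c ∷ []) _ ([] , _ , refl , _ , q-anti) = self c q-anti
      covered (c ∷ []) _ (_ ∷ [] , [] , refl , p-anti , _) = self c p-anti

    1≤k^ : ∀ h → 1 ≤ k ^ h
    1≤k^ h = m^n>0 k h

    -- With n = 1 + 2h this is δ(n(k^h - 1) + 1), the term subtracted in the formula for odd n.
    symmetricBound : ℕ → ℕ
    symmetricBound h = δ k + (1 + h * 2) * (δ k * (k ^ h ∸ 1))

    -- Blocks are single letters: each of the `n` reflections fixes `δ k * k ^ h` words, among them
    -- the `δ k` constant words with a self-negative letter.
    cover-odd : ∀ h → CoveredBy (1 + h * 2) (symmetricBound h)
    cover-odd h = subst₂ CoveredBy (*-identityʳ n) (cong (λ z → δ k + z) (trans (cong (sumBelow (λ _ → x)) (*-identityʳ n)) (sumBelow-const x n)))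
      (cover-powers (δ k) (λ _ → x) cover-one (λ { {zero} _ → ≤-reflexive (sym (*-identityʳ (δ k))) ; {suc _} (s≤s ()) }) λ {a} a<n → ≤-reflexive (begin
        #antiPalindromes (suc a) * #antiPalindromes (n * 1 ∸ suc a)   ≡⟨ #-product-odd (suc a) (n * 1 ∸ suc a) h (trans (m+[n∸m]≡n a<n) (*-identityʳ n)) ⟩
        δ k * k ^ h                                                   ≡⟨ cong (δ k *_) (m+[n∸m]≡n (1≤k^ h)) ⟨
        δ k * suc (k ^ h ∸ 1)                                         ≡⟨ *-suc (δ k) (k ^ h ∸ 1) ⟩
        δ k + x                                                       ∎))
      where
      open ≡-Reasoning
      n = 1 + h * 2
      x = δ k * (k ^ h ∸ 1)
      open Powers (h * 2) 0

    module _ {j h : ℕ} (j≤h : j ≤ h) where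

      k^j≤k^h : k ^ j ≤ k ^ h
      k^j≤k^h = ^-monoʳ-≤ k j≤h

      fixed≤odd-odd : δ k * k ^ j ≤ δ k * δ k * k ^ h
      fixed≤odd-odd = *-mono-≤ (m≤m*n (δ k) (δ k) {{>-nonZero (proj₁ (δ-bounds k))}}) k^j≤k^h

      fixed≤even-even : δ k * k ^ j ≤ k * k ^ h
      fixed≤even-even = *-mono-≤ (≤-trans (proj₂ (δ-bounds k)) (s≤s (s≤s (z≤n {1 + k-3})))) k^j≤k^h

      -- Blocks have the odd length `1 + j * 2`, so every reflection fixes at least `δ k * k ^ j`
      -- powers. Altogether it fixes `δ k * δ k * k ^ h` or `k * k ^ h` words, as its two parts have
      -- odd or even length.
      cover-even : ∀ r → suc h * 2 ≡ r * (1 + j * 2) → CoveredBy (suc h * 2)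
        (symmetricBound j + suc h * ((δ k * δ k * k ^ h ∸ δ k * k ^ j) + (k * k ^ h ∸ δ k * k ^ j)))
      cover-even (suc r-1) eq = subst₂ CoveredBy (sym eq) (cong (λ z → symmetricBound j + z) (trans (cong (sumBelow g) (sym eq)) (sumBelow-alternate x y (suc h))))
        (cover-powers c g (cover-odd j) (λ {a} a<d → ≤-reflexive (sym (#-product-odd (suc a) (1 + j * 2 ∸ suc a) j (m+[n∸m]≡n a<d)))) λ {a} a<n → bound a (complement a a<n))
        where
        open Powers r-1 (j * 2)
        n = suc r-1 * (1 + j * 2)
        c = δ k * k ^ j
        x = δ k * δ k * k ^ h ∸ c
        y = k * k ^ h ∸ c
        -- The first part has length `suc a`, so even `a` is the case of two odd parts.
        g = alternate x y
        complement : ∀ a → a < n → suc a + (n ∸ suc a) ≡ suc h * 2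
        complement a a<n = trans (m+[n∸m]≡n a<n) (sym eq)
        bound : ∀ a {b} → suc a + b ≡ suc h * 2 → #antiPalindromes (suc a) * #antiPalindromes b ≤ c + g a
        bound a {b} sum with parity a
        ... | inj₁ (i , refl) = ≤-reflexive (trans (#-product-odd-odd i b h sum)
                (sym (trans (cong (λ z → c + z) (alternate-even x y i)) (m+[n∸m]≡n fixed≤odd-odd))))
        ... | inj₂ (i , refl) = ≤-reflexive (trans (#-product-even (suc i) b (suc h) sum)
                (sym (trans (cong (λ z → c + z) (alternate-odd x y i)) (m+[n∸m]≡n fixed≤even-even))))

    -- `c` stands for twice the number of chosen words.
    twiceS-bound-odd : ∀ {c} n → n % 2 ≡ 1 → (∀ {b} → CoveredBy n b → k ^ n ≤ c + b) → twiceS k n ℤ.≤ + c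
    twiceS-bound-odd {c} n odd bound = twiceS-odd-≤ {k} n odd (subst (k ^ n ≤_) regroup
        (bound (subst (λ n → CoveredBy n (symmetricBound h)) (sym n≡) (cover-odd h))))
      where
      h = n / 2
      n≡ = odd-form n odd
      distribute : ∀ c d n x → c + (d + n * (d * x)) ≡ c + d * (n * x + 1)
      distribute = ℕSolver.solve-∀
      regroup : c + symmetricBound h ≡ c + δ k * (n * (k ^ h ∸ 1) + 1)
      regroup = trans (distribute c (δ k) (1 + h * 2) (k ^ h ∸ 1)) (cong (λ n → c + δ k * (n * (k ^ h ∸ 1) + 1)) (sym n≡))

    twiceS-bound-even : ∀ {c} n → 1 ≤ n → n % 2 ≡ 0 → (∀ {b} → CoveredBy n b → k ^ n ≤ c + b) → twiceS k n ℤ.≤ + c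
    twiceS-bound-even {c} n 1≤n even bound = go (n / 2) refl
      where
      m = oddPart n
      j = m / 2
      spec = oddPart-spec n 1≤n
      r = proj₁ spec
      m≡ : m ≡ 1 + j * 2
      m≡ = odd-form m (proj₂ (proj₂ spec))
      -- Generalising `n / 2` to a variable lets the truncated exponent `n / 2 ∸ 1` reduce in the
      -- successor case.
      go : ∀ h → n / 2 ≡ h → twiceS k n ℤ.≤ + c
      go zero eq = ⊥-elim (<⇒≢ 1≤n (sym (trans (even-form n even) (cong (_* 2) eq))))
      go (suc h) eq = twiceS-even-≤ {k} n even
          (subst (λ h → k ^ n + n * δ k * k ^ j ≤ c + (h * k ^ (h ∸ 1) * (δ k * δ k + k) + m * δ k * (k ^ j ∸ 1) + δ k)) (sym eq)
            (even-regroup {n} {k} {k ^ n} {c} {m} {h} n≡ (fixed≤odd-odd j≤h) (fixed≤even-even j≤h) covered))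
        where
        n≡ : n ≡ suc h * 2
        n≡ = trans (even-form n even) (cong (_* 2) eq)
        n≡r*m : suc h * 2 ≡ r * (1 + j * 2)
        n≡r*m = trans (sym n≡) (trans (proj₁ (proj₂ spec)) (cong (r *_) m≡))
        j≤h : j ≤ h
        j≤h = odd-divisor-≤-half r n≡r*m
        covered : k ^ n ≤ c + (δ k + m * (δ k * (k ^ j ∸ 1)) + suc h * ((δ k * δ k * k ^ h ∸ δ k * k ^ j) + (k * k ^ h ∸ δ k * k ^ j)))
        covered = subst (λ m′ → k ^ n ≤ c + (δ k + m′ * (δ k * (k ^ j ∸ 1)) + suc h * ((δ k * δ k * k ^ h ∸ δ k * k ^ j) + (k * k ^ h ∸ δ k * k ^ j))))
          (sym m≡) (bound (subst (λ n → CoveredBy n (symmetricBound j + suc h * ((δ k * δ k * k ^ h ∸ δ k * k ^ j) + (k * k ^ h ∸ δ k * k ^ j)))) (sym n≡) (cover-even j≤h r n≡r*m)))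

    twiceS-bound : ∀ {c} n → 1 ≤ n → (∀ {b} → CoveredBy n b → k ^ n ≤ c + b) → twiceS k n ℤ.≤ + c
    twiceS-bound n 1≤n bound with n%2≡0⊎1 n
    ... | inj₁ even = twiceS-bound-even n 1≤n even bound
    ... | inj₂ odd = twiceS-bound-odd n odd bound

  -- The factor 2 on the right clears the halving in s_k(n-1), whose double is `t`.
  scaled-bound : ∀ k t c {p} → t ℤ.≤ + (2 * c) → k * c ≤ p → + k ℤ.* t ℤ.≤ + 2 ℤ.* + p
  scaled-bound k t c {p} t≤2c kc≤p = begin
    + k ℤ.* t           ≤⟨ ℤₚ.*-monoˡ-≤-nonNeg (+ k) t≤2c ⟩
    + k ℤ.* + (2 * c)   ≡⟨ ℤₚ.pos-* k (2 * c) ⟨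
    + (k * (2 * c))     ≡⟨ cong (λ x → + x) (commute k c) ⟩
    + (2 * (k * c))     ≤⟨ ℤ.+≤+ (*-monoʳ-≤ 2 kc≤p) ⟩
    + (2 * p)           ≡⟨ ℤₚ.pos-* 2 p ⟩
    + 2 ℤ.* + p         ∎
    where
    open ℤₚ.≤-Reasoning
    commute : ∀ k c → k * (2 * c) ≡ 2 * (k * c)
    commute = ℕSolver.solve-∀


-- The sequence combined with the count of chosen words.

open import Data.Nat using (ℕ; _≥_; NonZero)
open import Data.Integer using (+_; _*_; _≤_)
open import Data.Fin using (Fin)
open import Data.Product using (Σ; _×_)
open import Data.Nat using (suc; zero; s≤s; z≤n)
open import Data.List using (length)
open import Data.Product using (map₂)
open Construction using (module Lift; module Bound; scaled-bound)

theorem5p8 : ∀ (n k : ℕ) → n ≥ 3 → k ≥ 3 →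
    Σ (ℕ → Fin k) λ s → Σ ℕ λ p → Σ (HasPeriod s p) λ hp →
    IsOrientable s p (Data.Nat.suc n) {{Data.Nat.>-nonZero (Data.Product.proj₁ hp)}}
    × (+ k) * twiceS k n ≤ (+ 2) * (+ p)
theorem5p8 n@(suc n-1) k@(suc (suc (suc k-3))) _ _ =
  -- Only the last component changes: the period bound `k * length chosenVecs ≤ p` is turned into
  -- the bound by `twiceS`.
  map₂ (map₂ (map₂ (map₂ (scaled-bound k (twiceS k n) (length (Lift.chosenVecs k-3 n-1))
    (Bound.twiceS-bound k-3 n (s≤s z≤n) (Bound.k^n-bound k-3))))))
    (Lift.orientable-sequence k-3 n-1)
theorem5p8 _ (suc zero) _ (s≤s ())
theorem5p8 _ (suc (suc zero)) _ (s≤s (s≤s ()))
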